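{- Let $t \geq 2$ be an integer. Then, as $n \to \infty$, $$ex\bigl(n, n^{\frac{t+2}{2t+1}}, \{C_4, \theta_{3,t}\}\bigr) = \Theta\bigl(n^{1+\frac{1}{2t+1}}\bigr).$$ That is, there exist constants $c_1, c_2 > 0$ (depending only on $t$) and $n_0$ such that for all integers $n \geq n_0$, $$c_1 n^{1+\frac{1}{2t+1}} \leq ex\bigl(n, \lfloor n^{\frac{t+2}{2t+1}} \rfloor, \{C_4, \theta_{3,t}\}\bigr) \leq c_2 n^{1+\frac{1}{2t+1}}.$$
   Context: For a family $\mathcal{F}$ of graphs, $ex(a,b,\mathcal{F})$ is the maximum number of edges in a bipartite graph whose part sizes are $a$ and $b$ and which contains no graph in $\mathcal{F}$ as a (not necessarily induced) subgraph. $C_4$ is the cycle of length 4. $\theta_{3,t}$ is the theta graph consisting of two vertices joined by $t$ internally vertex-disjoint paths, each with exactly 3 edges. When a part size is given by a non-integer real number, it is rounded down to an integer. -}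

module Defs where

open import Algebra.Definitions.RawSemiring using () renaming (_^_ to pow)
open import Data.Bool using (Bool; true; false; T; _∨_; if_then_else_)
open import Data.Bool.Properties using (T?; ∨-comm)
open import Data.Empty using (⊥-elim)
open import Data.Fin as Fin using (Fin)
open import Data.Fin.Patterns using (0F; 1F; 2F; 3F)
open import Data.Fin.Properties as Fin using (any?; all?; +↔⊎; *↔×)
open import Data.Fin.Subset using (Subset; ∣_∣)
open import Data.Fin.Subset.Properties using (anySubset?; ∣p∣≤n)
open import Data.Integer using (+_)
open import Data.List using (List)
open import Data.List.Relation.Unary.All as All using (All)
open import Data.Nat using (ℕ; zero; suc; _+_; _*_; _^_; _≤_; _<_; z≤n; NonZero)
open import Data.Nat.Properties as ℕ using (_≤?_)
open import Data.Product using (∃; ∃-syntax; _×_; _,_)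
open import Data.Rational as ℚ using (ℚ)
open import Data.Sum using (_⊎_; inj₁; inj₂)
open import Data.Sum.Function.Propositional using (_⊎-↔_)
open import Data.Vec as Vec using (Vec; []; _∷_; lookup; tabulate)
open import Data.Vec.Properties using (lookup∘tabulate)
open import Function using (_∘_; _↔_; Inverse; Injective)
open import Function.Construct.Composition using (_↔-∘_)
open import Function.Construct.Identity using (↔-id)
open import Level using () renaming (suc to lsuc)
open import Relation.Binary.PropositionalEquality using (_≡_; refl; sym; trans; cong; subst; subst₂; _≗_)
open import Relation.Nullary using (¬_; Dec; yes; no; does; ¬?; _×-dec_; _→-dec_)
open import Relation.Nullary.Decidable using (map′)
open import Relation.Unary using (Decidable)

record Graph : Set₁ where
  field
    Vertex     : Set
    order      : ℕ
    enum       : Fin order ↔ Vertex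
    adj        : Vertex → Vertex → Bool
    adj-sym    : ∀ u v → adj u v ≡ adj v u
    adj-irrefl : ∀ v → adj v v ≡ false

open Graph

IsEmbedding : (H G : Graph) → (Vertex H → Vertex G) → Set
IsEmbedding H G f =
  Injective _≡_ _≡_ f × (∀ u v → T (adj H u v) → T (adj G (f u) (f v)))

-- G contains H as a (not necessarily induced) subgraph.
_⊑_ : Graph → Graph → Set
H ⊑ G = ∃[ f ] IsEmbedding H G f

-- Each undirected edge is listed by `arc` in one direction only.

C₄ : Graph
C₄ = record
  { Vertex     = Fin 4
  ; order      = 4
  ; enum       = ↔-id (Fin 4)
  ; adj        = λ u v → arc u v ∨ arc v u
  ; adj-sym    = λ u v → ∨-comm (arc u v) (arc v u)
  ; adj-irrefl = λ { 0F → refl ; 1F → refl ; 2F → refl ; 3F → refl }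
  }
  where
  arc : Fin 4 → Fin 4 → Bool
  arc 0F 1F = true
  arc 1F 2F = true
  arc 2F 3F = true
  arc 3F 0F = true
  arc _  _  = false

-- The i-th path is  source — near i — far i — target.
ΘVertex : ℕ → Set
ΘVertex t = Fin 2 ⊎ (Fin t × Fin 2)

pattern source = inj₁ 0F
pattern target = inj₁ 1F
pattern near i = inj₂ (i , 0F)
pattern far  i = inj₂ (i , 1F)

θ₃ : ℕ → Graph
θ₃ t = record
  { Vertex     = ΘVertex t
  ; order      = 2 + t * 2
  ; enum       = (↔-id (Fin 2) ⊎-↔ *↔×) ↔-∘ +↔⊎
  ; adj        = λ u v → arc u v ∨ arc v u
  ; adj-sym    = λ u v → ∨-comm (arc u v) (arc v u)
  ; adj-irrefl = λ { source → refl ; target → refl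
                   ; (near i) → refl ; (far i) → refl }
  }
  where
  arc : ΘVertex t → ΘVertex t → Bool
  arc source   (near i) = true
  arc (near i) (far j)  = does (i Fin.≟ j)
  arc (far i)  target   = true
  arc _        _        = false

-- A bipartite graph with parts Fin a and Fin b, given by the neighbourhood
-- in Fin b of each vertex of Fin a.
Bipartite : ℕ → ℕ → Set
Bipartite a b = Vec (Subset b) a

⟦_⟧ : ∀ {a b} → Bipartite a b → Graph
⟦_⟧ {a} {b} G = record
  { Vertex     = Fin a ⊎ Fin b
  ; order      = a + b
  ; enum       = +↔⊎
  ; adj        = biadj
  ; adj-sym    = λ { (inj₁ _) (inj₁ _) → refl ; (inj₁ _) (inj₂ _) → refl
                   ; (inj₂ _) (inj₁ _) → refl ; (inj₂ _) (inj₂ _) → refl }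
  ; adj-irrefl = λ { (inj₁ _) → refl ; (inj₂ _) → refl }
  }
  where
  biadj : Fin a ⊎ Fin b → Fin a ⊎ Fin b → Bool
  biadj (inj₁ i) (inj₂ j) = lookup (lookup G i) j
  biadj (inj₂ j) (inj₁ i) = lookup (lookup G i) j
  biadj _        _        = false

#edges : ∀ {a b} → Bipartite a b → ℕ
#edges G = Vec.sum (Vec.map ∣_∣ G)

_Free_ : ∀ {a b} → List Graph → Bipartite a b → Set₁
𝓕 Free G = All (λ H → ¬ (H ⊑ ⟦ G ⟧)) 𝓕

Searchable : ∀ ℓ → Set → Set (lsuc ℓ)
Searchable ℓ A = ∀ {P : A → Set ℓ} → Decidable P → Dec (∃ P)

search-Vec : ∀ {ℓ A} → Searchable ℓ A → ∀ n → Searchable ℓ (Vec A n)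
search-Vec s zero    P? = map′ ([] ,_) (λ { ([] , p) → p }) (P? [])
search-Vec s (suc n) P? =
  map′ (λ { (x , xs , p) → x ∷ xs , p }) (λ { (x ∷ xs , p) → x , xs , p })
       (s (λ x → search-Vec s n (P? ∘ (x ∷_))))

module _ (G : Graph) where
  private module E = Inverse (enum G)

  search-Vertex : ∀ {ℓ} → Searchable ℓ (Vertex G)
  search-Vertex {P = P} P? =
    map′ (λ (i , p) → E.to i , p)
         (λ (v , p) → E.from v , subst P (sym (E.strictlyInverseˡ v)) p)
         (any? (P? ∘ E.to))

  all-Vertex? : ∀ {P : Vertex G → Set} → Decidable P → Dec (∀ v → P v)
  all-Vertex? {P} P? =
    map′ (λ h v → subst P (E.strictlyInverseˡ v) (h (E.from v)))
         (λ h i → h (E.to i))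
         (all? (P? ∘ E.to))

  _≟ⱽ_ : (u v : Vertex G) → Dec (u ≡ v)
  u ≟ⱽ v = map′ (λ e → trans (sym (E.strictlyInverseˡ u))
                             (trans (cong E.to e) (E.strictlyInverseˡ v)))
                (cong E.from) (E.from u Fin.≟ E.from v)

isEmbedding? : ∀ H G → Decidable (IsEmbedding H G)
isEmbedding? H G f =
  map′ (λ inj {u} {v} → inj u v) (λ inj u v → inj {u} {v})
    (all-Vertex? H λ u → all-Vertex? H λ v →
      _≟ⱽ_ G (f u) (f v) →-dec _≟ⱽ_ H u v)
  ×-dec
  (all-Vertex? H λ u → all-Vertex? H λ v →
    T? (adj H u v) →-dec T? (adj G (f u) (f v)))

isEmbedding-cong : ∀ H G {f g} → f ≗ g → IsEmbedding H G f → IsEmbedding H G g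
isEmbedding-cong H G f≗g (inj , hom) =
  (λ {u} {v} e → inj (trans (f≗g u) (trans e (sym (f≗g v))))) ,
  (λ u v e → subst₂ (λ x y → T (adj G x y)) (f≗g u) (f≗g v) (hom u v e))

_⊑?_ : ∀ H G → Dec (H ⊑ G)
H ⊑? G =
  map′ (λ (w , p) → lookup w ∘ E.from , p)
       (λ (f , p) → tabulate (f ∘ E.to) , isEmbedding-cong H G (eq f) p)
       (search-Vec (search-Vertex G) (order H)
         (λ w → isEmbedding? H G (lookup w ∘ E.from)))
  where
  module E = Inverse (enum H)
  eq : ∀ f → f ≗ lookup (tabulate (f ∘ E.to)) ∘ E.from
  eq f v = sym (trans (lookup∘tabulate (f ∘ E.to) (E.from v))
                      (cong f (E.strictlyInverseˡ v)))

free? : ∀ {a b} 𝓕 → Decidable (_Free_ {a} {b} 𝓕)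
free? 𝓕 G = All.all? (λ H → ¬? (H ⊑? ⟦ G ⟧)) 𝓕

-- The largest k ≤ bound satisfying P, or 0 if there is none.
greatest : ∀ {ℓ} {P : ℕ → Set ℓ} → Decidable P → (bound : ℕ) → ℕ
greatest P? zero    = zero
greatest P? (suc k) = if does (P? (suc k)) then suc k else greatest P? k

Attains : (a b : ℕ) → List Graph → ℕ → Set₁
Attains a b 𝓕 k = ∃[ G ] (𝓕 Free G × #edges {a} {b} G ≡ k)

attains? : ∀ a b 𝓕 → Decidable (Attains a b 𝓕)
attains? a b 𝓕 k =
  search-Vec anySubset? a (λ G → free? 𝓕 G ×-dec (#edges G ℕ.≟ k))

ex : (a b : ℕ) → List Graph → ℕ
ex a b 𝓕 = greatest (attains? a b 𝓕) (a * b)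

module _ {ℓ} {P : ℕ → Set ℓ} (P? : Decidable P) where

  greatest-upper : ∀ {j} k → j ≤ k → P j → j ≤ greatest P? k
  greatest-upper zero    j≤k Pj = j≤k
  greatest-upper (suc k) j≤k Pj with P? (suc k)
  ... | yes _ = j≤k
  ... | no ¬p with ℕ.m≤n⇒m<n∨m≡n j≤k
  ...   | inj₁ j<1+k = greatest-upper k (ℕ.≤-pred j<1+k) Pj
  ...   | inj₂ refl  = ⊥-elim (¬p Pj)

  greatest-holds : ∀ {j} k → j ≤ k → P j → P (greatest P? k)
  greatest-holds zero    z≤n Pj = Pj
  greatest-holds (suc k) j≤k Pj with P? (suc k)
  ... | yes p = p
  ... | no ¬p with ℕ.m≤n⇒m<n∨m≡n j≤k
  ...   | inj₁ j<1+k = greatest-holds k (ℕ.≤-pred j<1+k) Pj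
  ...   | inj₂ refl  = ⊥-elim (¬p Pj)

#edges≤a*b : ∀ {a b} (G : Bipartite a b) → #edges G ≤ a * b
#edges≤a*b []      = z≤n
#edges≤a*b (S ∷ G) = ℕ.+-mono-≤ (∣p∣≤n S) (#edges≤a*b G)

ex-upper : ∀ {a b} 𝓕 (G : Bipartite a b) → 𝓕 Free G → #edges G ≤ ex a b 𝓕
ex-upper {a} {b} 𝓕 G free =
  greatest-upper (attains? a b 𝓕) (a * b) (#edges≤a*b G) (G , free , refl)

ex-attained : ∀ {a b} 𝓕 (G : Bipartite a b) → 𝓕 Free G → Attains a b 𝓕 (ex a b 𝓕)
ex-attained {a} {b} 𝓕 G free =
  greatest-holds (attains? a b 𝓕) (a * b) (#edges≤a*b G) (G , free , refl)

-- ⌊ n^(p/q) ⌋ is the largest m with m^q ≤ n^p; for q ≥ 1 such m are at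
-- most n^p.
⌊_^[_/_]⌋ : (n p q : ℕ) .{{_ : NonZero q}} → ℕ
⌊ n ^[ p / q ]⌋ = greatest (λ m → m ^ q ≤? n ^ p) (n ^ p)

m≤m^q : ∀ m q .{{_ : NonZero q}} → m ≤ m ^ q
m≤m^q zero    q = z≤n
m≤m^q (suc m) (suc q) = ℕ.m≤m*n (suc m) (suc m ^ q) {{ℕ.m^n≢0 (suc m) q}}

floor-lower : ∀ n p q .{{_ : NonZero q}} → ⌊ n ^[ p / q ]⌋ ^ q ≤ n ^ p
floor-lower n p q@(suc _) =
  greatest-holds (λ m → m ^ q ≤? n ^ p) {0} (n ^ p) z≤n z≤n

floor-upper : ∀ n p q .{{_ : NonZero q}} → n ^ p < suc ⌊ n ^[ p / q ]⌋ ^ q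
floor-upper n p q = ℕ.≰⇒> λ le →
  ℕ.<-irrefl refl (greatest-upper (λ m → m ^ q ≤? n ^ p) (n ^ p)
    (ℕ.≤-trans (m≤m^q _ q) le) le)

ℕ→ℚ : ℕ → ℚ
ℕ→ℚ n = + n ℚ./ 1

_^ℚ_ : ℚ → ℕ → ℚ
_^ℚ_ = pow ℚ.+-*-rawSemiring

-- The real inequalities  c · n^(p/q) ≤ x  and  x ≤ c · n^(p/q),  with both
-- sides raised to the q-th power. This is an equivalence for q ≥ 1 and c ≥ 0
-- only, so c must not be negative.

_·_^[_/_]≤_ : (c : ℚ) (n p q x : ℕ) .{{_ : NonZero q}} → Set
c · n ^[ p / q ]≤ x = (c ^ℚ q) ℚ.* ℕ→ℚ (n ^ p) ℚ.≤ ℕ→ℚ x ^ℚ q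

_≤_·_^[_/_] : (x : ℕ) (c : ℚ) (n p q : ℕ) .{{_ : NonZero q}} → Set
x ≤ c · n ^[ p / q ] = ℕ→ℚ x ^ℚ q ℚ.≤ (c ^ℚ q) ℚ.* ℕ→ℚ (n ^ p)

{-# OPTIONS --safe #-}
module Submission where

-- Upper bound. In a C₄-free graph two 3-edge paths with the same ends are internally
-- disjoint, so without θ₃ t there are fewer than t of them for each pair of ends. In parts of
-- sizes a and b, the edges at vertices of degree at most a quarter of the average make up at
-- most half of the e edges, and each of the others is the middle edge of at least
-- (e / 8a)(e / 8b) paths. Hence e³ ≤ 128 t (ab)², unless e < 4a or e < 4b.
--
-- Lower bound. For a prime p of order n^(1 / (2t + 1)), join the points of the affine space of
-- dimension t + 2 over 𝔽ₚ to those lines whose direction (u , N(u) , 1) has u ∈ 𝔽ₚᵗ, where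
-- N(u) = u₀² - α u₁² + u₂³ + … + uₜ₋₁ᵗ and α is a nonresidue. A copy of θ₃ t yields t + 1 such
-- directions on a line at infinity, but N is a polynomial of degree between 2 and t on every
-- line of 𝔽ₚᵗ, so the graph of N has at most t points on a line. (For t = 2 the directions form
-- an elliptic quadric and the graph is the affine part of a generalised quadrangle.)

-- The construction has p^(2t + 1) lines, p^(t + 2) points and p points on each line, hence p^(2t +
-- 2) edges. For n about p^(2t + 1) these numbers have the orders n, n^((t + 2) / (2t + 1)) and n^(1
-- + 1 / (2t + 1)), and the last is also the order of (ab)^(2/3). Two opposing demands shape N.
-- Along a line its degree must be at least 2, because it is compared with an affine function, and
-- at most t, because a copy of θ₃ t supplies only t + 1 values. Distinct exponents 2, 3, ... for
-- all t coordinates would reach t + 1, so two coordinates share the exponent 2, and the nonresidue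
-- keeps their quadratic form from vanishing in any direction. Since n is arbitrary, a prime is
-- needed within a constant factor of every large number; upper and lower estimates for common
-- multiples of 1, ..., n provide it. Computation in 𝔽ₚ is carried out as divisibility by p in ℤ.

module PrimesInIntervals where

  open import Data.Nat using (pred; s≤s⁻¹; >-nonZero; ℕ; zero; suc; _+_; _*_; _^_; _∸_; _≤_; _<_; z≤n; s≤s; NonZero; _!; nonTrivial⇒n>1)
  open import Data.Nat.Properties
  open import Data.Nat.Divisibility
  open import Data.Nat.Combinatorics using (k![n∸k]!∣n!)
  open import Data.Nat.Primality
  import Data.Nat.Tactic.RingSolver as NatRing
  open import Data.Integer as ℤ using (ℤ; +_)
  import Data.Integer.Properties as ℤ
  import Data.Integer.Tactic.RingSolver as IntRing
  open import Data.Product using (∃-syntax; _×_; _,_)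
  open import Data.Sum using (inj₁; inj₂)
  open import Relation.Binary.PropositionalEquality
  open import Relation.Nullary.Decidable using (from-yes; _×-dec_)
  open import Relation.Nullary using (¬_; yes; no; contradiction)

  -- Common multiples of 1, ..., n and primes between consecutive powers of 4.

  prime∣!⇒≤ : ∀ {p} m → Prime p → p ∣ m ! → p ≤ m
  prime∣!⇒≤ zero pr d = contradiction (∣1⇒≡1 d) (λ { refl → ¬prime[1] pr })
  prime∣!⇒≤ (suc m) pr d with euclidsLemma (suc m) (m !) pr d
  ... | inj₁ e = ∣⇒≤ e
  ... | inj₂ e = m≤n⇒m≤1+n (prime∣!⇒≤ m pr e)

  0<m≤n⇒m∣n! : ∀ {m n} → m ≤ n → .{{_ : NonZero m}} → m ∣ n !
  0<m≤n⇒m∣n! {suc m} le = ∣-trans (m∣m*n (m !)) (m≤n⇒m!∣n! le)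

  Common : ℕ → ℕ → Set
  Common n D = (0 < D) × (∀ {j} → 0 < j → j ≤ n → j ∣ D)

  -- Leibniz's harmonic triangle: the numbers z i j = D ∙ i ! ∙ j ! / (i + j + 1) ! are
  -- integers because row i + 1 consists of differences of entries of row i.
  leibniz : ∀ {n D} → Common n D → ∀ i j → i + j < n →
            ∃[ z ] z ℤ.* + (suc (i + j) !) ≡ + (D * (i ! * j !))
  leibniz {D = D} (_ , c) zero j lt with c (s≤s z≤n) lt
  ... | divides q refl = + q , trans (sym (ℤ.pos-* q _)) (cong +_ (lem q (suc j) (j !)))
    where
    lem : ∀ q s f → q * (s * f) ≡ q * s * (1 * f)
    lem = NatRing.solve-∀
  leibniz {D = D} cm (suc i) j lt
    with leibniz cm i j (<-trans (n<1+n _) lt) | leibniz cm i (suc j) (≤-trans (s≤s (≤-reflexive (+-suc i j))) lt)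
  ... | x , ex | y , ey = x ℤ.- y , (begin
      (x ℤ.- y) ℤ.* + (suc (suc n) * F)
        ≡⟨ cong ((x ℤ.- y) ℤ.*_) (ℤ.pos-* (suc (suc n)) F) ⟩
      (x ℤ.- y) ℤ.* (+ suc (suc n) ℤ.* + F)
        ≡⟨ ring₁ x y (+ suc (suc n)) (+ F) ⟩
      + suc (suc n) ℤ.* (x ℤ.* + F) ℤ.- y ℤ.* (+ suc (suc n) ℤ.* + F)
        ≡⟨ cong₂ (λ u v → + suc (suc n) ℤ.* u ℤ.- v) ex
                 (trans (cong (y ℤ.*_) (sym (ℤ.pos-* (suc (suc n)) F)))
                        (trans (cong (λ k → y ℤ.* + (suc k !)) (sym (+-suc i j))) ey)) ⟩
      + suc (suc n) ℤ.* + A ℤ.- + (D * (i ! * (suc j * j !)))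
        ≡⟨ cong (ℤ._- + (D * (i ! * (suc j * j !)))) (sym (ℤ.pos-* (suc (suc n)) A)) ⟩
      + (suc (suc n) * A) ℤ.- + (D * (i ! * (suc j * j !)))
        ≡⟨ cong (λ k → + k ℤ.- + (D * (i ! * (suc j * j !)))) (ring₂ i j D (i !) (j !)) ⟩
      + (D * (i ! * (suc j * j !)) + D * (suc i * i ! * j !)) ℤ.- + (D * (i ! * (suc j * j !)))
        ≡⟨ cong (ℤ._- + (D * (i ! * (suc j * j !)))) (ℤ.pos-+ (D * (i ! * (suc j * j !))) _) ⟩
      + (D * (i ! * (suc j * j !))) ℤ.+ + (D * (suc i * i ! * j !)) ℤ.- + (D * (i ! * (suc j * j !)))
        ≡⟨ ring₃ (+ (D * (i ! * (suc j * j !)))) _ ⟩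
      + (D * (suc i * i ! * j !)) ∎)
    where
    open ≡-Reasoning
    n = i + j
    F = suc n !
    A = D * (i ! * j !)
    ring₁ : ∀ x y s f → (x ℤ.- y) ℤ.* (s ℤ.* f) ≡ s ℤ.* (x ℤ.* f) ℤ.- y ℤ.* (s ℤ.* f)
    ring₁ = IntRing.solve-∀
    ring₂ : ∀ i j D f g → suc (suc (i + j)) * (D * (f * g)) ≡ D * (f * (suc j * g)) + D * (suc i * f * g)
    ring₂ = NatRing.solve-∀
    ring₃ : ∀ a b → a ℤ.+ b ℤ.- a ≡ b
    ring₃ = IntRing.solve-∀

  -- Equivalent to bounding the integral of xᵐ(1 - x)ᵐ over [0, 1], which is m!² / (2m + 1)!, by
  -- means of x(1 - x) ≤ 1/4.
  4^m*m!²≤[1+2m]! : ∀ m → 4 ^ m * (m ! * m !) ≤ suc (m + m) !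
  4^m*m!²≤[1+2m]! zero = s≤s z≤n
  4^m*m!²≤[1+2m]! (suc m) = begin
    4 * 4 ^ m * (suc m * m ! * (suc m * m !))        ≡⟨ ring m (4 ^ m) (m !) ⟩
    suc m * suc m * 4 * (4 ^ m * (m ! * m !))        ≤⟨ *-mono-≤ le (4^m*m!²≤[1+2m]! m) ⟩
    suc (suc (suc (m + m))) * suc (suc (m + m)) * suc (m + m) !  ≡⟨ *-assoc (suc (suc (suc (m + m)))) (suc (suc (m + m))) (suc (m + m) !) ⟩
    suc (suc (suc (m + m))) !                        ≡⟨ cong (λ k → suc (suc k) !) (sym (+-suc m m)) ⟩
    suc (suc (m + suc m)) ! ∎
    where
    open ≤-Reasoning
    ring : ∀ m a f → 4 * a * (suc m * f * (suc m * f)) ≡ suc m * suc m * 4 * (a * (f * f))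
    ring = NatRing.solve-∀
    ring′ : ∀ m → suc m * suc m * 4 + (m + m + 2) ≡ suc (suc (suc (m + m))) * suc (suc (m + m))
    ring′ = NatRing.solve-∀
    le : suc m * suc m * 4 ≤ suc (suc (suc (m + m))) * suc (suc (m + m))
    le = ≤-trans (m≤m+n _ _) (≤-reflexive (ring′ m))

  -- The entry D ∙ m!² / (2m + 1)! of the triangle is an integer and positive, hence at least 1.
  4^m≤common : ∀ m {n D} → m + m < n → Common n D → 4 ^ m ≤ D
  4^m≤common m {D = D} lt cm@(0<D , _) with leibniz cm m m lt
  ... | + zero , eq = contradiction (ℤ.+-injective (sym eq)) (>⇒≢ (*-mono-≤ 0<D (*-mono-≤ (1≤n! m) (1≤n! m))))
  -- Once the factorial is matched against a successor, its product with a negative integer computes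
  -- to a negative one, and `eq` becomes absurd.
  ... | ℤ.-[1+ z ] , eq with suc (m + m) ! | 1≤n! (suc (m + m))
  ...   | suc f | _ with eq
  ...     | ()
  4^m≤common m {D = D} lt cm@(0<D , _) | + suc z , eq =
    *-cancelʳ-≤ (4 ^ m) D (m ! * m !) {{m*n≢0 (m !) (m !) {{m !≢0}} {{m !≢0}}}} (begin
      4 ^ m * (m ! * m !)      ≤⟨ 4^m*m!²≤[1+2m]! m ⟩
      suc (m + m) !            ≤⟨ m≤n*m (suc (m + m) !) (suc z) ⟩
      suc z * suc (m + m) !    ≡⟨ ℤ.+-injective (trans (ℤ.pos-* (suc z) _) eq) ⟩
      D * (m ! * m !) ∎)
    where open ≤-Reasoning

  -- A composite j ≤ 2m is f · g with f ≤ s and g ≤ m, hence divides s ! ∙ D.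
  common-double : ∀ {m D} c s → 0 < c → m + m ≤ s * s →
    (∀ {p} → Prime p → m < p → p ≤ m + m → p ∣ c) →
    Common m D → Common (m + m) (D * c * s !)
  common-double {m} {D} c s 0<c 2m≤s² hc (0<D , h) = *-mono-≤ (*-mono-≤ 0<D 0<c) (1≤n! s) , go
    where
    split : ∀ {f g} → 1 < f → 0 < g → f ≤ s → f * g ≤ m + m → f * g ∣ D * c * s !
    split {f} {g} 1<f 0<g f≤s fg≤2m = subst (_∣ D * c * s !) (*-comm g f)
      (*-pres-∣ (∣m⇒∣m*n c (h 0<g g≤m)) (0<m≤n⇒m∣n! f≤s {{>-nonZero (<-trans (s≤s z≤n) 1<f)}}))
      where
      g≤m : g ≤ m
      g≤m = *-cancelˡ-≤ 2 (≤-trans (*-monoˡ-≤ g 1<f) (≤-trans fg≤2m (≤-reflexive (cong (_+_ m) (sym (+-identityʳ m))))))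
    go : ∀ {j} → 0 < j → j ≤ m + m → j ∣ D * c * s !
    go {j} 0<j j≤2m with j ≤? m
    ... | yes j≤m = ∣m⇒∣m*n (s !) (∣m⇒∣m*n c (h 0<j j≤m))
    go {suc zero} _ _ | no _ = 1∣ _
    go {j@(suc (suc _))} 0<j j≤2m | no j≰m with composite? j
    ... | no ¬comp = ∣m⇒∣m*n (s !) (∣n⇒∣m*n D (hc (¬composite⇒prime ¬comp) (≰⇒> j≰m) j≤2m))
    ... | yes (composite {f} f<j f∣j@(divides g eq)) with f ≤? s
    ...   | yes f≤s = subst (_∣ D * c * s !) (trans (*-comm f g) (sym eq))
                       (split (nonTrivial⇒n>1 f) (<-trans (s≤s z≤n) (quotient>1 f∣j f<j)) f≤s
                         (≤-trans (≤-reflexive (trans (*-comm f g) (sym eq))) j≤2m))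
    ...   | no f≰s with g ≤? s
    ...     | yes g≤s = subst (_∣ D * c * s !) (sym eq)
                         (split (quotient>1 f∣j f<j) (<-trans (s≤s z≤n) (nonTrivial⇒n>1 f)) g≤s
                           (≤-trans (≤-reflexive (sym eq)) j≤2m))
    ...     | no g≰s = contradiction
                         (≤-trans (*-mono-≤ (≰⇒> g≰s) (≰⇒> f≰s))
                           (≤-trans (≤-reflexive (sym eq)) (≤-trans j≤2m 2m≤s²)))
                         (<⇒≱ (*-mono-< (n<1+n s) (n<1+n s)))

  [2m]!≤4^m*m!² : ∀ m → (m + m) ! ≤ 4 ^ m * (m ! * m !)
  [2m]!≤4^m*m!² zero = s≤s z≤n
  [2m]!≤4^m*m!² (suc m) = begin
    (suc m + suc m) !                          ≡⟨ cong (λ k → suc k !) (+-suc m m) ⟩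
    suc (suc (m + m)) * (suc (m + m) * (m + m) !) ≡⟨ sym (*-assoc (suc (suc (m + m))) (suc (m + m)) ((m + m) !)) ⟩
    suc (suc (m + m)) * suc (m + m) * (m + m) !  ≤⟨ *-mono-≤ le ([2m]!≤4^m*m!² m) ⟩
    suc m * suc m * 4 * (4 ^ m * (m ! * m !))  ≡⟨ ring m (4 ^ m) (m !) ⟩
    4 * 4 ^ m * (suc m * m ! * (suc m * m !)) ∎
    where
    open ≤-Reasoning
    ring : ∀ m a f → suc m * suc m * 4 * (a * (f * f)) ≡ 4 * a * (suc m * f * (suc m * f))
    ring = NatRing.solve-∀
    ring′ : ∀ m → suc (suc (m + m)) * suc (m + m) + (m + m + 2) ≡ suc m * suc m * 4
    ring′ = NatRing.solve-∀
    le : suc (suc (m + m)) * suc (m + m) ≤ suc m * suc m * 4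
    le = ≤-trans (m≤m+n _ _) (≤-reflexive (ring′ m))

  -- The witness is the central binomial coefficient: a prime in (m , 2m] divides (2m)! but not m!.
  central : ∀ m → ∃[ c ] ((0 < c) × (c ≤ 4 ^ m) ×
            (∀ {p} → Prime p → m < p → p ≤ m + m → p ∣ c))
  central m with k![n∸k]!∣n! (m≤m+n m m)
  ... | divides c eq = c , pos c eq′ , c≤4^m , p∣c
    where
    eq′ : (m + m) ! ≡ c * (m ! * m !)
    eq′ = trans eq (cong (λ k → c * (m ! * k !)) (m+n∸m≡n m m))
    pos : ∀ c → (m + m) ! ≡ c * (m ! * m !) → 0 < c
    pos zero e = contradiction e (>⇒≢ (1≤n! (m + m)))
    pos (suc _) _ = s≤s z≤n
    c≤4^m : c ≤ 4 ^ m
    c≤4^m = *-cancelʳ-≤ c (4 ^ m) (m ! * m !) {{m*n≢0 (m !) (m !) {{m !≢0}} {{m !≢0}}}}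
              (≤-trans (≤-reflexive (sym eq′)) ([2m]!≤4^m*m!² m))
    p∣c : ∀ {p} → Prime p → m < p → p ≤ m + m → p ∣ c
    p∣c {p} pr m<p p≤2m with euclidsLemma c (m ! * m !) pr
                               (subst (p ∣_) eq′ (0<m≤n⇒m∣n! p≤2m {{prime⇒nonZero pr}}))
    ... | inj₁ d = d
    ... | inj₂ d with euclidsLemma (m !) (m !) pr d
    ...   | inj₁ e = contradiction (prime∣!⇒≤ m pr e) (<⇒≱ m<p)
    ...   | inj₂ e = contradiction (prime∣!⇒≤ m pr e) (<⇒≱ m<p)

  2^-square : ∀ {k} h → k ≤ h + h → 2 ^ k ≤ 2 ^ h * 2 ^ h
  2^-square {k} h le = ≤-trans (^-monoʳ-≤ 2 le) (≤-reflexive (^-distribˡ-+-* 2 h h))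

  2^suc : ∀ k → 2 ^ k + 2 ^ k ≡ 2 ^ suc k
  2^suc k = cong (_+_ (2 ^ k)) (sym (+-identityʳ _))

  -- Each doubling costs a central binomial coefficient and a factorial. The bounds on the
  -- coefficients multiply to 4^(1 + 2 + ... + 2^(k - 1)), which is below 4^(2^k). The square roots
  -- that occur are at most 2^h because k ≤ 2h, so one factorial serves every step.
  common-2^ : ∀ h k → k ≤ h + h → ∃[ D ] (Common (2 ^ k) D × D ≤ 4 ^ (2 ^ k) * ((2 ^ h) !) ^ k)
  common-2^ h zero _ = 1 , (s≤s z≤n , λ { {suc zero} _ _ → 1∣ 1 ; {suc (suc _)} _ (s≤s ()) }) , s≤s z≤n
  common-2^ h (suc k) k<2h with common-2^ h k (<⇒≤ k<2h) | central (2 ^ k)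
  ... | D , cm , D≤ | c , 0<c , c≤ , hc =
    _ , subst (λ n → Common n (D * c * (2 ^ h) !)) (2^suc k)
          (common-double c (2 ^ h) 0<c (≤-trans (≤-reflexive (2^suc k)) (2^-square h k<2h)) hc cm) ,
    (begin
      D * c * S                          ≤⟨ *-monoˡ-≤ S (*-mono-≤ D≤ c≤) ⟩
      4 ^ (2 ^ k) * S ^ k * 4 ^ (2 ^ k) * S  ≡⟨ ring (4 ^ (2 ^ k)) (S ^ k) S ⟩
      4 ^ (2 ^ k) * 4 ^ (2 ^ k) * (S * S ^ k) ≡⟨ cong (_* (S * S ^ k)) (sym (^-distribˡ-+-* 4 (2 ^ k) (2 ^ k))) ⟩
      4 ^ (2 ^ k + 2 ^ k) * S ^ suc k    ≡⟨ cong (λ n → 4 ^ n * S ^ suc k) (2^suc k) ⟩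
      4 ^ (2 ^ suc k) * S ^ suc k ∎)
    where
    open ≤-Reasoning
    S = (2 ^ h) !
    ring : ∀ a b s → a * b * a * s ≡ a * a * (s * b)
    ring = NatRing.solve-∀

  n!≤n^n : ∀ n → n ! ≤ n ^ n
  n!≤n^n zero = ≤-refl
  n!≤n^n (suc n) = *-monoʳ-≤ (suc n) (≤-trans (n!≤n^n n) (^-monoˡ-≤ n (n≤1+n n)))

  -- The comparison of exponents that decides `prime-gap-impossible`, and the origin of 8: at
  -- exponent 7 it reads 130 ≤ 128 and fails.
  2[h+1]²+2≤2^h : ∀ d → 2 * (suc (8 + d) * suc (8 + d)) + 2 ≤ 2 ^ (8 + d)
  2[h+1]²+2≤2^h zero = from-yes (164 ≤? 256)
  2[h+1]²+2≤2^h (suc d) = begin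
    2 * (suc (8 + suc d) * suc (8 + suc d)) + 2  ≤⟨ m≤m+n _ (126 + 32 * d + 2 * (d * d)) ⟩
    2 * (suc (8 + suc d) * suc (8 + suc d)) + 2 + (126 + 32 * d + 2 * (d * d)) ≡⟨ ring d ⟩
    2 * (2 * (suc (8 + d) * suc (8 + d)) + 2)    ≤⟨ *-monoʳ-≤ 2 (2[h+1]²+2≤2^h d) ⟩
    2 * 2 ^ (8 + d)                              ≡⟨ cong (2 ^_) (sym (+-suc 8 d)) ⟩
    2 ^ (8 + suc d) ∎
    where
    open ≤-Reasoning
    ring : ∀ d → 2 * (suc (8 + suc d) * suc (8 + suc d)) + 2 + (126 + 32 * d + 2 * (d * d)) ≡ 2 * (2 * (suc (8 + d) * suc (8 + d)) + 2)
    ring = NatRing.solve-∀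

  -- Without such a prime, doubling a common multiple of 1 , … , 4 ^ h twice costs only
  -- factorials of square roots, which makes it smaller than 4^m≤common allows.
  prime-gap-impossible : ∀ h → 8 ≤ h →
    ¬ (∀ {p} → Prime p → 2 ^ (h + h) < p → ¬ (p ≤ 2 ^ (suc h + suc h)))
  prime-gap-impossible h 8≤h none with common-2^ (suc h) (h + h) (+-mono-≤ (n≤1+n h) (n≤1+n h))
  ... | D , cm , D≤ = <⇒≱ final (2^-cancel-≤ chain)
    where
    open ≤-Reasoning
    S = (2 ^ suc h) !
    X = 2 ^ h
    m = 2 ^ (h + h)
    2m = 2 ^ suc (h + h)
    4m = 2 ^ suc (suc (h + h))
    eq4 : 4m ≡ 2 ^ (suc h + suc h)
    eq4 = cong (λ k → 2 ^ suc k) (sym (+-suc h h))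
    cm₂ : Common 2m (D * 1 * S)
    cm₂ = subst (λ n → Common n (D * 1 * S)) (2^suc (h + h))
      (common-double 1 (2 ^ suc h) (s≤s z≤n)
        (≤-trans (≤-reflexive (2^suc (h + h))) (2^-square (suc h) (s≤s (+-monoʳ-≤ h (n≤1+n h)))))
        (λ pr m<p p≤2m → contradiction
           (≤-trans p≤2m (≤-trans (≤-reflexive (2^suc (h + h)))
              (≤-trans (^-monoʳ-≤ 2 (n≤1+n (suc (h + h)))) (≤-reflexive eq4))))
           (none pr m<p))
        cm)
    cm₄ : Common 4m (D * 1 * S * 1 * S)
    cm₄ = subst (λ n → Common n (D * 1 * S * 1 * S)) (2^suc (suc (h + h)))
      (common-double 1 (2 ^ suc h) (s≤s z≤n)
        (≤-trans (≤-reflexive (2^suc (suc (h + h)))) (2^-square (suc h) (≤-reflexive (cong suc (sym (+-suc h h))))))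
        (λ pr 2m<p p≤4m → contradiction
           (≤-trans p≤4m (≤-reflexive (trans (2^suc (suc (h + h))) eq4)))
           (none pr (≤-<-trans (^-monoʳ-≤ 2 (n≤1+n (h + h))) 2m<p)))
        cm₂)
    e = h + h
    pred2m : suc (pred 2m) ≡ 2m
    pred2m = suc-pred 2m {{m^n≢0 2 (suc (h + h))}}
    -- `4^m≤common` asks for twice the exponent to lie strictly below `4m`, hence `pred`; `chain`
    -- multiplies the lost factor 4 back in.
    lower : 4 ^ pred 2m ≤ D * 1 * S * 1 * S
    lower = 4^m≤common (pred 2m) (≤-trans (+-monoʳ-≤ (suc (pred 2m)) (n≤1+n _))
              (≤-reflexive (trans (cong₂ _+_ pred2m pred2m) (2^suc (suc (h + h)))))) cm₄
    S≤ : S ≤ 2 ^ (suc h * 2 ^ suc h)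
    S≤ = ≤-trans (n!≤n^n (2 ^ suc h)) (≤-reflexive (^-*-assoc 2 (suc h) (2 ^ suc h)))
    -- The exponent of 2 in the bound for all factors `S` together. It equals 4(h + 1)²X with X² =
    -- m, so it is of order h²√m and loses against the 2m that separates the two estimates.
    E = suc h * 2 ^ suc h * suc (suc (h + h))
    4^≡ : ∀ k → 4 ^ k ≡ 2 ^ (2 * k)
    4^≡ k = ^-*-assoc 2 2 k
    chain : 2 ^ (2 * 2m) ≤ 2 ^ (2 + (2 * m + E))
    chain = begin
      2 ^ (2 * 2m)                 ≡⟨ sym (4^≡ 2m) ⟩
      4 ^ 2m                       ≡⟨ cong (4 ^_) (sym pred2m) ⟩
      4 * 4 ^ pred 2m              ≤⟨ *-monoʳ-≤ 4 lower ⟩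
      4 * (D * 1 * S * 1 * S)      ≡⟨ ring D S ⟩
      4 * (D * (S * S))            ≤⟨ *-monoʳ-≤ 4 (*-monoˡ-≤ (S * S) D≤) ⟩
      4 * (4 ^ m * S ^ e * (S * S)) ≡⟨ ring′ (4 ^ m) (S ^ e) S ⟩
      4 * (4 ^ m * S ^ suc (suc e)) ≤⟨ *-monoʳ-≤ 4 (*-monoʳ-≤ (4 ^ m) (^-monoˡ-≤ (suc (suc e)) S≤)) ⟩
      4 * (4 ^ m * (2 ^ (suc h * 2 ^ suc h)) ^ suc (suc e)) ≡⟨ cong₂ (λ a b → 4 * (a * b)) (4^≡ m) (^-*-assoc 2 (suc h * 2 ^ suc h) (suc (suc e))) ⟩
      2 ^ 2 * (2 ^ (2 * m) * 2 ^ E) ≡⟨ cong (2 ^ 2 *_) (sym (^-distribˡ-+-* 2 (2 * m) E)) ⟩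
      2 ^ 2 * 2 ^ (2 * m + E)      ≡⟨ sym (^-distribˡ-+-* 2 2 (2 * m + E)) ⟩
      2 ^ (2 + (2 * m + E)) ∎
      where
      ring : ∀ D S → 4 * (D * 1 * S * 1 * S) ≡ 4 * (D * (S * S))
      ring = NatRing.solve-∀
      ring′ : ∀ a b s → 4 * (a * b * (s * s)) ≡ 4 * (a * (s * (s * b)))
      ring′ = NatRing.solve-∀
    2^-cancel-≤ : ∀ {a b} → 2 ^ a ≤ 2 ^ b → a ≤ b
    2^-cancel-≤ {a} {b} le = ≮⇒≥ (λ b<a → <⇒≱ (^-monoʳ-< 2 (s≤s (s≤s z≤n)) b<a) le)
    X-big : 2 * (suc h * suc h) + 2 ≤ X
    X-big = subst (λ h → 2 * (suc h * suc h) + 2 ≤ 2 ^ h) (m+[n∸m]≡n 8≤h) (2[h+1]²+2≤2^h (h ∸ 8))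
    0<X : 0 < X
    0<X = m^n>0 2 h
    final : 2 + (2 * m + E) < 2 * 2m
    final = begin-strict
      2 + (2 * m + E)   ≡⟨ cong (λ k → 2 + (2 * k + E)) (^-distribˡ-+-* 2 h h) ⟩
      2 + (2 * (X * X) + E)  ≡⟨ ring h X ⟩
      2 * (X * X) + (2 + 2 * X * (2 * (suc h * suc h)))  <⟨ +-monoʳ-< (2 * (X * X)) (+-monoˡ-< (2 * X * (2 * (suc h * suc h))) (*-mono-≤ (s≤s (s≤s (s≤s (z≤n {1})))) 0<X)) ⟩
      2 * (X * X) + (4 * X + 2 * X * (2 * (suc h * suc h))) ≡⟨ ring′ X (2 * (suc h * suc h)) ⟩
      2 * (X * X) + 2 * X * (2 * (suc h * suc h) + 2)  ≤⟨ +-monoʳ-≤ (2 * (X * X)) (*-monoʳ-≤ (2 * X) X-big) ⟩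
      2 * (X * X) + 2 * X * X ≡⟨ ring″ X ⟩
      2 * (2 * (X * X)) ≡⟨ cong (λ k → 2 * (2 * k)) (sym (^-distribˡ-+-* 2 h h)) ⟩
      2 * 2m ∎
      where
      ring : ∀ h x → 2 + (2 * (x * x) + suc h * (2 * x) * suc (suc (h + h))) ≡ 2 * (x * x) + (2 + 2 * x * (2 * (suc h * suc h)))
      ring = NatRing.solve-∀
      ring′ : ∀ x k → 2 * (x * x) + (4 * x + 2 * x * k) ≡ 2 * (x * x) + 2 * x * (k + 2)
      ring′ = NatRing.solve-∀
      ring″ : ∀ x → 2 * (x * x) + 2 * x * x ≡ 2 * (2 * (x * x))
      ring″ = NatRing.solve-∀

  -- The ratio 4 reflects the estimates: a common multiple of 1, ..., N is at least about 2^N, while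
  -- the one constructed is about 4^N. One doubling free of primes leaves these compatible, two do
  -- not.
  prime-between : ∀ h → 8 ≤ h → ∃[ p ] (Prime p × 4 ^ h < p × p ≤ 4 ^ suc h)
  prime-between h 8≤h with anyUpTo? (λ p → prime? p ×-dec (4 ^ h <? p)) (suc (4 ^ suc h))
  ... | yes (p , p< , pr , lt) = p , pr , lt , s≤s⁻¹ p<
  ... | no none = contradiction
    (λ {p} pr lt le → none (p , s≤s (subst (p ≤_) (4^≡ (suc h)) le) , pr , subst (_< p) (4^≡ h) lt))
    (prime-gap-impossible h 8≤h)
    where
    4^≡ : ∀ k → 2 ^ (k + k) ≡ 4 ^ k
    4^≡ k = trans (cong (λ j → 2 ^ (k + j)) (sym (+-identityʳ k))) (sym (^-*-assoc 2 2 k))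

-- Polynomials modulo p, quadratic nonresidues, and the norm form along a line.

module PolynomialsModP where

  open import Data.Nat as ℕ using (ℕ; zero; suc; s≤s)
  import Data.Nat.Properties as ℕ
  import Data.Nat.Divisibility as ℕ
  open import Data.Nat.Coprimality using (coprime-Bézout; prime⇒coprime)
  open import Data.Nat.GCD using (module Bézout)
  open import Data.Nat.Primality
  open import Data.Integer as ℤ using (ℤ; +_; _+_; _*_; _-_; -_; _^_; 0ℤ; 1ℤ)
  open import Data.Integer.DivMod using (_%ℕ_; _/ℕ_; n%ℕd<d; a≡a%ℕn+[a/ℕn]*n)
  open import Data.Integer.Divisibility.Signed
  import Data.Integer.Properties as ℤ
  open import Data.Integer.Tactic.RingSolver using (solve-∀)
  open import Data.Fin as Fin using (Fin; zero; suc; toℕ; fromℕ<; inject₁; punchOut)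
  import Data.Fin.Properties as Fin
  open import Data.Product using (∃-syntax; _×_; _,_; proj₁; proj₂)
  open import Data.Sum using (_⊎_; inj₁; inj₂; [_,_]′)
  open import Relation.Binary.PropositionalEquality
  open import Relation.Nullary using (¬_; yes; no; contradiction)
  open import Function using (_∘_; id)

  -- Deg d l f: f is a polynomial function of degree ≤ d whose coefficient at degree d is l.
  Deg : ℕ → ℤ → (ℤ → ℤ) → Set
  Deg zero    l f = ∀ x → f x ≡ l
  Deg (suc d) l f = ∃[ c ] ∃[ g ] (Deg d l g × (∀ x → f x ≡ c + x * g x))

  deg-const+ : ∀ {d l f} c → Deg (suc d) l f → Deg (suc d) l (λ x → c + f x)
  deg-const+ c (b , g , Dg , eq) = c + b , g , Dg , λ x → trans (cong (_+_ c) (eq x)) (sym (ℤ.+-assoc c b _))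

  deg-+ : ∀ d {k l f g} → Deg d k f → Deg d l g → Deg d (k + l) (λ x → f x + g x)
  deg-+ zero    Df Dg x = cong₂ _+_ (Df x) (Dg x)
  deg-+ (suc d) (a , f , Df , p) (b , g , Dg , q) =
    a + b , _ , deg-+ d Df Dg , λ x → trans (cong₂ _+_ (p x) (q x)) (ring a b x (f x) (g x))
    where
    ring : ∀ a b x f g → a + x * f + (b + x * g) ≡ a + b + x * (f + g)
    ring = solve-∀

  deg-scale : ∀ d {l f} a → Deg d l f → Deg d (a * l) (λ x → a * f x)
  deg-scale zero    a Df x = cong (a *_) (Df x)
  deg-scale (suc d) a (c , g , Dg , p) =
    a * c , _ , deg-scale d a Dg , λ x → trans (cong (a *_) (p x)) (ring a c x (g x))
    where
    ring : ∀ a c x g → a * (c + x * g) ≡ a * c + x * (a * g)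
    ring = solve-∀

  deg-raise : ∀ d {l f} → Deg d l f → Deg (suc d) 0ℤ f
  deg-raise zero {l} Df = l , (λ _ → 0ℤ) , (λ _ → refl) ,
    λ x → trans (Df x) (sym (trans (cong (_+_ l) (ℤ.*-zeroʳ x)) (ℤ.+-identityʳ l)))
  deg-raise (suc d) (c , g , Dg , p) = c , g , deg-raise d Dg , p

  deg-linear-* : ∀ d {l f} u w → Deg d l f → Deg (suc d) (w * l) (λ x → (u + x * w) * f x)
  deg-linear-* zero {l} u w Df = u * l , _ , (λ _ → refl) , λ x → trans (cong ((u + x * w) *_) (Df x)) (ring u w x l)
    where
    ring : ∀ u w x l → (u + x * w) * l ≡ u * l + x * (w * l)
    ring = solve-∀
  deg-linear-* (suc d) u w (c , g , Dg , p) =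
    u * c , _ , deg-const+ (w * c) (deg-linear-* d u w Dg) ,
    λ x → trans (cong ((u + x * w) *_) (p x)) (ring u w x c (g x))
    where
    ring : ∀ u w x c g → (u + x * w) * (c + x * g) ≡ u * c + x * (w * c + (u + x * w) * g)
    ring = solve-∀

  deg-power : ∀ d u w → Deg d (w ^ d) (λ x → (u + x * w) ^ d)
  deg-power zero    u w x = refl
  deg-power (suc d) u w = deg-linear-* d u w (deg-power d u w)

  deg-cong : ∀ d {l f g} → (∀ x → f x ≡ g x) → Deg d l f → Deg d l g
  deg-cong zero    eq Df x = trans (sym (eq x)) (Df x)
  deg-cong (suc d) eq (c , h , Dh , p) = c , h , Dh , λ x → trans (sym (eq x)) (p x)

  -- From f = c + x g one gets f(x) - f(a) = (x - a) g(x) + a (g(x) - g(a)), and g is divided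
  -- recursively. What matters is that l survives: `roots⇒lead` divides until only l is left.
  deg-quotient : ∀ d {l f} a → Deg (suc d) l f →
                 ∃[ h ] (Deg d l h × (∀ x → f x - f a ≡ (x - a) * h x))
  deg-quotient zero {l} {f} a (c , g , Dg , p) = g , Dg , λ x → begin
    f x - f a                          ≡⟨ cong₂ _-_ (p x) (p a) ⟩
    c + x * g x - (c + a * g a)        ≡⟨ cong (λ k → c + x * g x - (c + a * k)) (trans (Dg a) (sym (Dg x))) ⟩
    c + x * g x - (c + a * g x)        ≡⟨ ring c x a (g x) ⟩
    (x - a) * g x ∎
    where
    open ≡-Reasoning
    ring : ∀ c x a g → c + x * g - (c + a * g) ≡ (x - a) * g
    ring = solve-∀
  deg-quotient (suc d) {l} {f} a (c , g , Dg , p) with deg-quotient d a Dg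
  ... | h , Dh , q = _ , subst (λ k → Deg (suc d) k _) lead (deg-+ (suc d) Dg (deg-raise d (deg-scale d a Dh))) ,
    λ x → begin
      f x - f a                              ≡⟨ cong₂ _-_ (p x) (p a) ⟩
      c + x * g x - (c + a * g a)            ≡⟨ ring₁ c x a (g x) (g a) ⟩
      (x - a) * g x + a * (g x - g a)        ≡⟨ cong (λ k → (x - a) * g x + a * k) (q x) ⟩
      (x - a) * g x + a * ((x - a) * h x)    ≡⟨ ring₂ x a (g x) (h x) ⟩
      (x - a) * (g x + a * h x) ∎
    where
    open ≡-Reasoning
    lead : l + 0ℤ ≡ l
    lead = ℤ.+-identityʳ l
    ring₁ : ∀ c x a g k → c + x * g - (c + a * k) ≡ (x - a) * g + a * (g - k)
    ring₁ = solve-∀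
    ring₂ : ∀ x a g h → (x - a) * g + a * ((x - a) * h) ≡ (x - a) * (g + a * h)
    ring₂ = solve-∀

  -- With t = 2 + k. The first two terms are the norm form of 𝔽ₚ(√α); each later coordinate has an
  -- exponent of its own, so that along a line the leading coefficient singles out one coordinate of
  -- the direction.
  normForm : ℤ → ℕ → (ℕ → ℤ) → ℤ
  normForm α zero    u = u 0 * u 0 - α * (u 1 * u 1)
  normForm α (suc k) u = normForm α k u + u (2 ℕ.+ k) ^ (3 ℕ.+ k)

  -- The subtracted affine part has degree at most 1 and cannot reach the leading degree. The
  -- coefficient is existential but computes: to w₀² - αw₁² for `zero`, and to 0 plus the (3 + k)-th
  -- power of `w (2 + k)` for `suc k`. `normForm-line` relies on these values.
  deg-normForm : ∀ α k (u w : ℕ → ℤ) v →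
    ∃[ l ] Deg (2 ℕ.+ k) l (λ x → normForm α k (λ i → u i + x * w i) - normForm α k u - x * v)
  deg-normForm α zero u w v = _ ,
    (0ℤ , _ , (+ 2 * u 0 * w 0 - α * (+ 2 * u 1 * w 1) - v , (λ _ → w 0 * w 0 - α * (w 1 * w 1)) , (λ _ → refl) , λ x → refl) ,
     λ x → ring α (u 0) (u 1) (w 0) (w 1) v x)
    where
    ring : ∀ α u u' w w' v x →
      (u + x * w) * (u + x * w) - α * ((u' + x * w') * (u' + x * w')) - (u * u - α * (u' * u')) - x * v
      ≡ 0ℤ + x * ((+ 2 * u * w - α * (+ 2 * u' * w') - v) + x * (w * w - α * (w' * w')))
    ring = solve-∀
  deg-normForm α (suc k) u w v with deg-normForm α k u w v
  ... | l , D = _ , deg-cong (3 ℕ.+ k)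
      (λ x → ring (normForm α k (λ i → u i + x * w i)) (normForm α k u) (x * v) (u (2 ℕ.+ k) ^ (3 ℕ.+ k)) ((u (2 ℕ.+ k) + x * w (2 ℕ.+ k)) ^ (3 ℕ.+ k)))
      (deg-+ (3 ℕ.+ k) (deg-raise (2 ℕ.+ k) D)
        (deg-const+ (- (u (2 ℕ.+ k) ^ (3 ℕ.+ k))) (deg-power (3 ℕ.+ k) (u (2 ℕ.+ k)) (w (2 ℕ.+ k)))))
    where
    ring : ∀ a b v c e → a - b - v + (- c + e) ≡ a + e - (b + c) - v
    ring = solve-∀

  module _ {p : ℕ} (pr : Prime p) where

    private
      P : ℤ
      P = + p
      instance
        nz : ℕ.NonZero p
        nz = prime⇒nonZero pr

    -- Stands in for computation in 𝔽ₚ: a congruence is derived as an explicit integer combination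
    -- of known ones, and the identity behind it is left to the ring solver.
    ∣-lin : ∀ {x y z} c d → P ∣ x → P ∣ y → z ≡ c * x + d * y → P ∣ z
    ∣-lin c d px py eq = subst (P ∣_) (sym eq) (∣m∣n⇒∣m+n (∣n⇒∣m*n c px) (∣n⇒∣m*n d py))

    ∣-mul : ∀ {x z} c → P ∣ x → z ≡ c * x → P ∣ z
    ∣-mul c px eq = subst (P ∣_) (sym eq) (∣n⇒∣m*n c px)

    ∣0 : P ∣ 0ℤ
    ∣0 = divides 0ℤ refl

    euclid : ∀ x y → P ∣ x * y → P ∣ x ⊎ P ∣ y
    euclid x y d with euclidsLemma ℤ.∣ x ∣ ℤ.∣ y ∣ pr (subst (p ℕ.∣_) (ℤ.abs-* x y) (∣⇒∣ᵤ d))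
    ... | inj₁ e = inj₁ (∣ᵤ⇒∣ e)
    ... | inj₂ e = inj₂ (∣ᵤ⇒∣ e)

    ∤1 : ¬ (P ∣ 1ℤ)
    ∤1 d = contradiction (ℕ.∣1⇒≡1 (∣⇒∣ᵤ d)) (λ { refl → ¬prime[1] pr })

    ∣^⇒∣ : ∀ x n → P ∣ x ^ n → P ∣ x
    ∣^⇒∣ x zero d = contradiction d ∤1
    ∣^⇒∣ x (suc n) d = [ id , ∣^⇒∣ x n ]′ (euclid x (x ^ n) d)

    ∣-⇒∣^-^ : ∀ x y n → P ∣ x - y → P ∣ x ^ n - y ^ n
    ∣-⇒∣^-^ x y zero d = ∣0
    ∣-⇒∣^-^ x y (suc n) d = ∣-lin (x ^ n) y d (∣-⇒∣^-^ x y n d) (ring x y (x ^ n) (y ^ n))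
      where
      ring : ∀ x y a b → x * a - y * b ≡ a * (x - y) + y * (a - b)
      ring = solve-∀

    residue : ∀ a → ∃[ i ] (P ∣ a - + toℕ {p} i)
    residue a = fromℕ< (n%ℕd<d a p) , divides (a /ℕ p)
      (trans (cong₂ (λ x y → x - + y) (a≡a%ℕn+[a/ℕn]*n a p) (Fin.toℕ-fromℕ< (n%ℕd<d a p)))
             (ring (+ (a %ℕ p)) (a /ℕ p * P)))
      where
      ring : ∀ x y → x + y - x ≡ y
      ring = solve-∀

    residue-≤ : ∀ {m n} → n ℕ.≤ m → m ℕ.< p → P ∣ + m - + n → m ℕ.≤ n
    residue-≤ {m} {n} n≤m m<p d with m ℕ.∸ n in eq
    ... | zero = ℕ.m∸n≡0⇒m≤n eq
    ... | suc k = contradiction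
      (ℕ.∣⇒≤ (subst (p ℕ.∣_) eq (∣⇒∣ᵤ (subst (P ∣_) (trans (ℤ.m-n≡m⊖n m n) (ℤ.⊖-≥ n≤m)) d))))
      (ℕ.<⇒≱ (ℕ.≤-<-trans (ℕ.≤-trans (ℕ.≤-reflexive (sym eq)) (ℕ.m∸n≤m m n)) m<p))

    residue-unique : ∀ {m n} → m ℕ.< p → n ℕ.< p → P ∣ + m - + n → m ≡ n
    residue-unique {m} {n} m<p n<p d with ℕ.≤-total n m
    ... | inj₁ n≤m = ℕ.≤-antisym (residue-≤ n≤m m<p d) n≤m
    ... | inj₂ m≤n = ℕ.≤-antisym m≤n (residue-≤ m≤n n<p (∣-mul (- 1ℤ) d (ring (+ m) (+ n))))
      where
      ring : ∀ x y → y - x ≡ - 1ℤ * (x - y)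
      ring = solve-∀

    inverse : ∀ a → ¬ (P ∣ a) → ∃[ b ] (P ∣ b * a - 1ℤ)
    inverse a p∤a with residue a
    ... | i , d with toℕ i in eqi | Fin.toℕ<n i
    ...   | zero | _ = contradiction (subst (P ∣_) (ℤ.+-identityʳ a) d) p∤a
    ...   | suc n | lt with coprime-Bézout (prime⇒coprime pr lt)
    ...     | Bézout.+- x y eq = - + y , ∣-lin (- + y) (- + x) d (∣-refl {P}) (begin
                - + y * a - 1ℤ                                    ≡⟨ ring (+ y) a (+ suc n) ⟩
                - + y * (a - + suc n) - (1ℤ + + y * + suc n)      ≡⟨ cong (λ k → - + y * (a - + suc n) - k)
                    (trans (cong (_+_ 1ℤ) (sym (ℤ.pos-* y (suc n)))) (trans (sym (ℤ.pos-+ 1 (y ℕ.* suc n))) (trans (cong +_ eq) (ℤ.pos-* x p)))) ⟩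
                - + y * (a - + suc n) - + x * P                   ≡⟨ ring′ (- + y * (a - + suc n)) (+ x) P ⟩
                - + y * (a - + suc n) + - + x * P ∎)
      where
      open ≡-Reasoning
      ring : ∀ y a s → - y * a - 1ℤ ≡ - y * (a - s) - (1ℤ + y * s)
      ring = solve-∀
      ring′ : ∀ a x q → a - x * q ≡ a + - x * q
      ring′ = solve-∀
    ...     | Bézout.-+ x y eq = + y , ∣-lin (+ y) (+ x) d (∣-refl {P}) (begin
                + y * a - 1ℤ                                      ≡⟨ ring (+ y) a (+ suc n) ⟩
                + y * (a - + suc n) + (+ y * + suc n - 1ℤ)        ≡⟨ cong (λ k → + y * (a - + suc n) + (k - 1ℤ))
                    (trans (sym (ℤ.pos-* y (suc n))) (trans (cong +_ (sym eq)) (trans (ℤ.pos-+ 1 (x ℕ.* p)) (cong (_+_ 1ℤ) (ℤ.pos-* x p))))) ⟩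
                + y * (a - + suc n) + (1ℤ + + x * P - 1ℤ)         ≡⟨ ring′ (+ y * (a - + suc n)) (+ x) P ⟩
                + y * (a - + suc n) + + x * P ∎)
      where
      open ≡-Reasoning
      ring : ∀ y a s → y * a - 1ℤ ≡ y * (a - s) + (y * s - 1ℤ)
      ring = solve-∀
      ring′ : ∀ a x q → a + (1ℤ + x * q - 1ℤ) ≡ a + x * q
      ring′ = solve-∀

    Distinct : ∀ {n} → (Fin n → ℤ) → Set
    Distinct r = ∀ i j → i ≢ j → ¬ (P ∣ r i - r j)

    -- Lagrange's theorem for the leading coefficient: the quotient by x - r₀ has the same one and,
    -- p being prime, vanishes modulo p at the remaining roots.
    roots⇒lead : ∀ d {l f} → Deg d l f → (r : Fin (suc d) → ℤ) → Distinct r →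
                 (∀ i → P ∣ f (r i)) → P ∣ l
    roots⇒lead zero    D r r≢ f∣ = subst (P ∣_) (D (r zero)) (f∣ zero)
    roots⇒lead (suc d) {f = f} D r r≢ f∣ with deg-quotient d (r zero) D
    ... | h , Dh , q = roots⇒lead d Dh (r ∘ suc) (λ i j i≢j → r≢ (suc i) (suc j) (i≢j ∘ Fin.suc-injective))
      λ i → [ (λ e → contradiction e (r≢ (suc i) zero λ ())) , id ]′
              (euclid (r (suc i) - r zero) (h (r (suc i)))
                (subst (P ∣_) (q (r (suc i))) (∣m∣n⇒∣m-n (f∣ (suc i)) (f∣ zero))))

    Anisotropic : ℤ → Set
    Anisotropic α = ∀ x y → P ∣ x * x - α * (y * y) → P ∣ x × P ∣ y

    -- The top coordinate is peeled off. The leading coefficient is a power of the top coordinate of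
    -- w, so p divides that coordinate; modulo p the top term is then constant along the line and
    -- cancels. The smaller form is left with one root to spare, which `inject₁` drops. For `zero`
    -- the leading coefficient is the anisotropic form itself.
    normForm-line : ∀ {α} → Anisotropic α → ∀ k (u w : ℕ → ℤ) v (r : Fin (3 ℕ.+ k) → ℤ) → Distinct r →
      (∀ i → P ∣ normForm α k (λ j → u j + r i * w j) - normForm α k u - r i * v) →
      ∀ j → j ℕ.< 2 ℕ.+ k → P ∣ w j
    normForm-line {α} an zero u w v r r≢ roots = go
      where
      lead : P ∣ w 0 × P ∣ w 1
      lead = an (w 0) (w 1) (roots⇒lead 2 (proj₂ (deg-normForm α zero u w v)) r r≢ roots)
      go : ∀ j → j ℕ.< 2 → P ∣ w j
      go zero _ = proj₁ lead
      go (suc zero) _ = proj₂ lead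
      go (suc (suc _)) (s≤s (s≤s ()))
    normForm-line {α} an (suc k) u w v r r≢ roots = go
      where
      top = 2 ℕ.+ k
      last : P ∣ w top
      last = ∣^⇒∣ (w top) (3 ℕ.+ k)
        (subst (P ∣_) (ℤ.+-identityˡ (w top ^ (3 ℕ.+ k))) (roots⇒lead (3 ℕ.+ k) (proj₂ (deg-normForm α (suc k) u w v)) r r≢ roots))
      ring₁ : ∀ u x w → u + x * w - u ≡ x * w
      ring₁ = solve-∀
      ring₂ : ∀ a b v c e → a - b - v ≡ 1ℤ * (a + e - (b + c) - v) + - 1ℤ * (e - c)
      ring₂ = solve-∀
      roots′ : ∀ i → P ∣ normForm α k (λ j → u j + r (inject₁ i) * w j) - normForm α k u - r (inject₁ i) * v
      roots′ i = ∣-lin 1ℤ (- 1ℤ) (roots (inject₁ i))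
        (∣-⇒∣^-^ (u top + x * w top) (u top) (3 ℕ.+ k) (∣-mul x last (ring₁ (u top) x (w top))))
        (ring₂ (normForm α k (λ j → u j + x * w j)) (normForm α k u) (x * v) (u top ^ (3 ℕ.+ k)) ((u top + x * w top) ^ (3 ℕ.+ k)))
        where x = r (inject₁ i)
      go : ∀ j → j ℕ.< 3 ℕ.+ k → P ∣ w j
      go j j< with ℕ.m≤n⇒m<n∨m≡n (ℕ.s≤s⁻¹ j<)
      ... | inj₁ lt = normForm-line an k u w v (r ∘ inject₁)
                        (λ i j i≢j → r≢ (inject₁ i) (inject₁ j) (i≢j ∘ Fin.inject₁-injective)) roots′ j lt
      ... | inj₂ refl = last

    -- Otherwise squaring would permute the residues, but it identifies 1 and -1.
    nonresidue : p ≢ 2 → ∃[ α ] (∀ x → ¬ (P ∣ x * x - α))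
    nonresidue p≢2 with Fin.all? (λ (α : Fin p) → Fin.any? (λ (x : Fin p) → P ∣? + toℕ x * + toℕ x - + toℕ α))
    ... | no ¬all with Fin.¬∀⟶∃¬ p _ (λ (α : Fin p) → Fin.any? (λ (x : Fin p) → P ∣? + toℕ x * + toℕ x - + toℕ α)) ¬all
    ...   | α , ¬sq = + toℕ α , λ x d → let i , e = residue x in
              ¬sq (i , ∣-lin 1ℤ (- (x + + toℕ i)) d e (ring (+ toℕ i) x (+ toℕ α)))
      where
      ring : ∀ i x α → i * i - α ≡ 1ℤ * (x * x - α) + - (x + i) * (x - i)
      ring = solve-∀
    -- `g` chooses square roots, so it is injective. With x the root chosen for 1, it misses -x: if
    -- `g i` were -x, then i ≡ x² ≡ 1, so `g i` would be x and p would divide 2x. Punching out that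
    -- value squeezes p residues into p - 1.
    nonresidue p≢2 | yes sq = contradiction (ℕ.≤-trans (ℕ.≤-reflexive (ℕ.suc-pred p)) (Fin.injective⇒≤ {f = g′} g′-inj)) ℕ.1+n≰n
      where
      g : Fin p → Fin p
      g = proj₁ ∘ sq
      g-sq : ∀ α → P ∣ + toℕ (g α) * + toℕ (g α) - + toℕ α
      g-sq = proj₂ ∘ sq
      fin-eq : ∀ (i j : Fin p) → P ∣ + toℕ i - + toℕ j → i ≡ j
      fin-eq i j d = Fin.toℕ-injective (residue-unique (Fin.toℕ<n i) (Fin.toℕ<n j) d)
      g-inj : ∀ {i j} → g i ≡ g j → i ≡ j
      g-inj {i} {j} eq = fin-eq i j (∣-lin 1ℤ (- 1ℤ) (subst (λ k → P ∣ + toℕ k * + toℕ k - + toℕ j) (sym eq) (g-sq j)) (g-sq i)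
        (ring (+ toℕ (g i) * + toℕ (g i)) (+ toℕ i) (+ toℕ j)))
        where
        ring : ∀ s i j → i - j ≡ 1ℤ * (s - j) + - 1ℤ * (s - i)
        ring = solve-∀
      one : Fin p
      one = proj₁ (residue 1ℤ)
      x : ℤ
      x = + toℕ (g one)
      x²≡1 : P ∣ x * x - 1ℤ
      x²≡1 = ∣-lin 1ℤ (- 1ℤ) (g-sq one) (proj₂ (residue 1ℤ)) (ring (x * x) (+ toℕ one))
        where
        ring : ∀ s o → s - 1ℤ ≡ 1ℤ * (s - o) + - 1ℤ * (1ℤ - o)
        ring = solve-∀
      neg : Fin p
      neg = proj₁ (residue (- x))
      neg≡-x : P ∣ - x - + toℕ neg
      neg≡-x = proj₂ (residue (- x))
      ∤2x : ¬ (P ∣ + 2 * x)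
      ∤2x d with euclid (+ 2) x d
      ... | inj₁ e = p≢2 (ℕ.≤-antisym (ℕ.∣⇒≤ (∣⇒∣ᵤ e)) (ℕ.nonTrivial⇒n>1 p {{prime⇒nonTrivial pr}}))
      ... | inj₂ e = ∤1 (∣-lin x (- 1ℤ) e x²≡1 (ring x))
        where
        ring : ∀ x → 1ℤ ≡ x * x + - 1ℤ * (x * x - 1ℤ)
        ring = solve-∀
      g≢neg : ∀ i → neg ≢ g i
      g≢neg i eq = ∤2x (∣-mul (- 1ℤ) (subst (λ k → P ∣ - x - + toℕ k) (trans eq (cong g i≡one)) neg≡-x) (ring x))
        where
        y : ℤ
        y = + toℕ (g i)
        ring : ∀ x → + 2 * x ≡ - 1ℤ * (- x - x)
        ring = solve-∀
        ring′ : ∀ i o x y → i - o ≡ 1ℤ * (1ℤ * (1ℤ - o) + - 1ℤ * (y * y - i)) + 1ℤ * ((x - y) * (- x - y) + 1ℤ * (x * x - 1ℤ))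
        ring′ = solve-∀
        i≡one : i ≡ one
        i≡one = fin-eq i one (∣-lin 1ℤ 1ℤ
          (∣-lin 1ℤ (- 1ℤ) (proj₂ (residue 1ℤ)) (g-sq i) refl)
          (∣-lin (x - y) 1ℤ (subst (λ k → P ∣ - x - + toℕ k) eq neg≡-x) x²≡1 refl)
          (ring′ (+ toℕ i) (+ toℕ one) x y))
      cast : Fin p → Fin (suc (ℕ.pred p))
      cast = subst Fin (sym (ℕ.suc-pred p))
      cast-inj : ∀ {i j} → cast i ≡ cast j → i ≡ j
      cast-inj = subst-injective (sym (ℕ.suc-pred p))
      g′ : Fin p → Fin (ℕ.pred p)
      g′ i = punchOut {i = cast neg} {j = cast (g i)} (g≢neg i ∘ cast-inj)
      g′-inj : ∀ {i j} → g′ i ≡ g′ j → i ≡ j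
      g′-inj {i} {j} eq = g-inj (cast-inj (Fin.punchOut-injective (g≢neg i ∘ cast-inj) (g≢neg j ∘ cast-inj) eq))

    -- If y is invertible, a zero of the form makes α the square of x / y.
    anisotropic : p ≢ 2 → ∃[ α ] Anisotropic α
    anisotropic p≢2 with nonresidue p≢2
    ... | α , nonres = α , an
      where
      an : Anisotropic α
      an x y d with P ∣? y
      ... | yes p∣y = ([ id , id ]′ (euclid x x (∣-lin 1ℤ (α * y) d p∣y (ring x α y)))) , p∣y
        where
        ring : ∀ x α y → x * x ≡ 1ℤ * (x * x - α * (y * y)) + α * y * y
        ring = solve-∀
      ... | no p∤y with inverse y p∤y
      ...   | z , e = contradiction
        (∣-lin (z * z) (α * (z * y + 1ℤ)) d e (ring x α y z)) (nonres (z * x))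
        where
        ring : ∀ x α y z → z * x * (z * x) - α ≡ z * z * (x * x - α * (y * y)) + α * (z * y + 1ℤ) * (z * y - 1ℤ)
        ring = solve-∀

-- Base-p digits, and the incidence of points and lines over 𝔽ₚ.

module LinesOverFp where

  open PolynomialsModP
  open import Data.Nat as ℕ using (ℕ; zero; suc; s≤s; z≤n; _/_; _%_)
  import Data.Nat.Properties as ℕ
  import Data.Nat.DivMod as ℕ
  import Data.Nat.Divisibility as ℕ
  open import Data.Nat.Primality
  open import Data.Bool using (true; false; if_then_else_)
  open import Data.Integer as ℤ using (ℤ; +_; _+_; _*_; _-_; -_; _^_; 0ℤ; 1ℤ)
  open import Data.Integer.Divisibility.Signed
  import Data.Integer.Properties as ℤ
  open import Data.Integer.Tactic.RingSolver using (solve-∀)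
  open import Data.Fin as Fin using (Fin; zero; suc; toℕ)
  import Data.Fin.Properties as Fin
  open import Data.Product using (proj₁; proj₂)
  open import Data.Sum using (inj₁; inj₂; [_,_]′)
  open import Relation.Binary.PropositionalEquality
  open import Relation.Nullary using (¬_; Dec; yes; no; contradiction; does)
  open import Relation.Nullary.Decidable using (dec-true; dec-false)
  open import Function using (_∘_; id)

  module _ (p : ℕ) .{{_ : ℕ.NonZero p}} where

    digit : ℕ → ℕ → ℕ
    digit x zero    = x % p
    digit x (suc k) = digit (x / p) k

    digit< : ∀ x k → digit x k ℕ.< p
    digit< x zero    = ℕ.m%n<n x p
    digit< x (suc k) = digit< (x / p) k

    digits-injective : ∀ K {x y} → x ℕ.< p ℕ.^ K → y ℕ.< p ℕ.^ K →
                       (∀ k → k ℕ.< K → digit x k ≡ digit y k) → x ≡ y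
    digits-injective zero (s≤s z≤n) (s≤s z≤n) _ = refl
    digits-injective (suc K) {x} {y} x< y< eq = begin
      x                      ≡⟨ ℕ.m≡m%n+[m/n]*n x p ⟩
      x % p ℕ.+ x / p ℕ.* p  ≡⟨ cong₂ (λ a b → a ℕ.+ b ℕ.* p) (eq 0 (s≤s z≤n))
                                  (digits-injective K (quot x<) (quot y<) (λ k k<K → eq (suc k) (s≤s k<K))) ⟩
      y % p ℕ.+ y / p ℕ.* p  ≡⟨ sym (ℕ.m≡m%n+[m/n]*n y p) ⟩
      y ∎
      where
      open ≡-Reasoning
      quot : ∀ {z} → z ℕ.< p ℕ.^ suc K → z / p ℕ.< p ℕ.^ K
      quot {z} z< = ℕ.m<n*o⇒m/o<n (subst (z ℕ.<_) (ℕ.*-comm p (p ℕ.^ K)) z<)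

    fromDigits : ℕ → (ℕ → ℕ) → ℕ
    fromDigits zero    f = 0
    fromDigits (suc K) f = f 0 ℕ.+ fromDigits K (f ∘ suc) ℕ.* p

    fromDigits< : ∀ K f → (∀ k → f k ℕ.< p) → fromDigits K f ℕ.< p ℕ.^ K
    fromDigits< zero    f f< = s≤s z≤n
    fromDigits< (suc K) f f< = ℕ.≤-trans (ℕ.+-monoˡ-≤ _ (f< 0))
      (ℕ.≤-trans (ℕ.*-monoˡ-≤ p (fromDigits< K (f ∘ suc) (f< ∘ suc))) (ℕ.≤-reflexive (ℕ.*-comm (p ℕ.^ K) p)))

    digit-fromDigits : ∀ K f → (∀ k → f k ℕ.< p) → ∀ k → k ℕ.< K → digit (fromDigits K f) k ≡ f k
    digit-fromDigits (suc K) f f< zero k< =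
      trans (ℕ.[m+kn]%n≡m%n (f 0) (fromDigits K (f ∘ suc)) p) (ℕ.m<n⇒m%n≡m (f< 0))
    digit-fromDigits (suc K) f f< (suc k) (s≤s k<) = trans
      (cong (λ x → digit x k)
        (trans (ℕ.+-distrib-/-∣ʳ (f 0) (ℕ.n∣m*n (fromDigits K (f ∘ suc))))
               (cong₂ ℕ._+_ (ℕ.m<n⇒m/n≡0 (f< 0)) (ℕ.m*n/n≡m (fromDigits K (f ∘ suc)) p))))
      (digit-fromDigits K (f ∘ suc) (f< ∘ suc) k k<)

  -- Points (Y , s) and lines (A , u) are numbers given by their digits in base p, where
  -- A and Y have t + 1 coordinates and u has t. The line consists of the points
  -- (A + s ∙ dir u , s), where dir u lists u and its norm form.
  module Incidence {p : ℕ} (pr : Prime p) {α : ℤ} (an : Anisotropic pr α) (k : ℕ) where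

    private
      t = 2 ℕ.+ k
      P : ℤ
      P = + p
      instance
        nz : ℕ.NonZero p
        nz = prime⇒nonZero pr

    #lines #points : ℕ
    #lines  = p ℕ.^ (1 ℕ.+ t ℕ.+ t)
    #points = p ℕ.^ (2 ℕ.+ t)

    coord : ℕ → ℕ → ℤ
    coord x i = + digit p x i

    slope : ℕ → ℕ → ℤ
    slope x i = coord x (1 ℕ.+ t ℕ.+ i)

    dir : ℕ → ℕ → ℤ
    dir x i = if does (i ℕ.<? t) then slope x i else normForm α k (slope x)

    param : ℕ → ℤ
    param y = coord y (1 ℕ.+ t)

    Inc : ℕ → ℕ → Set
    Inc x y = ∀ {i} → i ℕ.< 1 ℕ.+ t → P ∣ coord y i - (coord x i + param y * dir x i)

    inc? : ∀ x y → Dec (Inc x y)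
    inc? x y = ℕ.allUpTo? (λ i → P ∣? coord y i - (coord x i + param y * dir x i)) (1 ℕ.+ t)

    dir-< : ∀ x {i} → i ℕ.< t → dir x i ≡ slope x i
    dir-< x {i} i<t = cong (λ b → if b then slope x i else normForm α k (slope x)) (dec-true (i ℕ.<? t) i<t)

    dir-t : ∀ x → dir x t ≡ normForm α k (slope x)
    dir-t x = cong (λ b → if b then slope x t else normForm α k (slope x)) (dec-false (t ℕ.<? t) (ℕ.<-irrefl refl))

    digit-unique : ∀ x y i j → P ∣ coord x i - coord y j → digit p x i ≡ digit p y j
    digit-unique x y i j = residue-unique pr (digit< p x i) (digit< p y j)

    lines-equal : ∀ {x x'} → x ℕ.< #lines → x' ℕ.< #lines →
      (∀ {i} → i ℕ.< 1 ℕ.+ t → P ∣ coord x i - coord x' i) →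
      (∀ {i} → i ℕ.< t → P ∣ slope x i - slope x' i) → x ≡ x'
    lines-equal {x} {x'} x< x'< cA cu = digits-injective p (1 ℕ.+ t ℕ.+ t) x< x'< eq
      where
      eq : ∀ i → i ℕ.< 1 ℕ.+ t ℕ.+ t → digit p x i ≡ digit p x' i
      eq i i< with i ℕ.<? 1 ℕ.+ t
      ... | yes i<1+t = digit-unique x x' i i (cA i<1+t)
      ... | no i≮1+t = subst (λ j → digit p x j ≡ digit p x' j) i≡
        (digit-unique x x' (1 ℕ.+ t ℕ.+ (i ℕ.∸ (1 ℕ.+ t))) (1 ℕ.+ t ℕ.+ (i ℕ.∸ (1 ℕ.+ t))) (cu (ℕ.+-cancelˡ-< (1 ℕ.+ t) _ _ (subst (ℕ._< 1 ℕ.+ t ℕ.+ t) (sym i≡) i<))))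
        where
        i≡ : 1 ℕ.+ t ℕ.+ (i ℕ.∸ (1 ℕ.+ t)) ≡ i
        i≡ = ℕ.m+[n∸m]≡n (ℕ.≮⇒≥ i≮1+t)

    points-equal : ∀ {x y y'} → y ℕ.< #points → y' ℕ.< #points → Inc x y → Inc x y' →
                   P ∣ param y - param y' → y ≡ y'
    points-equal {x} {y} {y'} y< y'< inc inc' ds = digits-injective p (2 ℕ.+ t) y< y'< eq
      where
      ring : ∀ Y Y' A U s s' → Y - Y' ≡ 1ℤ * (Y - (A + s * U)) + 1ℤ * (U * (s - s') + - 1ℤ * (Y' - (A + s' * U)))
      ring = solve-∀
      eq : ∀ i → i ℕ.< 2 ℕ.+ t → digit p y i ≡ digit p y' i
      eq i i< with ℕ.m≤n⇒m<n∨m≡n (ℕ.s≤s⁻¹ i<)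
      ... | inj₁ i<1+t = digit-unique y y' i i
        (∣-lin pr 1ℤ 1ℤ (inc i<1+t) (∣-lin pr (dir x i) (- 1ℤ) ds (inc' i<1+t) refl)
          (ring (coord y i) (coord y' i) (coord x i) (dir x i) (param y) (param y')))
      ... | inj₂ refl = digit-unique y y' i i ds

    -- Subtracting the incidences at the two points leaves (s - s')(dir x - dir x') ≡ 0 in every
    -- coordinate; equal directions and a common point then force equal base points.
    two-points : ∀ {x x' y y'} → x ℕ.< #lines → x' ℕ.< #lines →
      Inc x y → Inc x' y → Inc x y' → Inc x' y' → ¬ (P ∣ param y - param y') → x ≡ x'
    two-points {x} {x'} {y} {y'} x< x'< i₁ i₂ i₃ i₄ s≢ = lines-equal x< x'<
      (λ {i} i< → ∣-lin pr 1ℤ 1ℤ (∣-lin pr 1ℤ (- 1ℤ) (i₂ i<) (i₁ i<) refl) (∣-mul pr (- param y) (dirs i<) refl)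
         (ring₂ (coord y i) (coord x i) (coord x' i) (dir x i) (dir x' i) (param y)))
      (λ {i} i<t → subst (P ∣_) (cong₂ _-_ (dir-< x i<t) (dir-< x' i<t)) (dirs (ℕ.m≤n⇒m≤1+n i<t)))
      where
      ring₁ : ∀ Y Y' A A' U U' s s' → (s - s') * (U - U') ≡
        1ℤ * (1ℤ * (Y - (A' + s * U')) + - 1ℤ * (Y - (A + s * U))) + - 1ℤ * (1ℤ * (Y' - (A' + s' * U')) + - 1ℤ * (Y' - (A + s' * U)))
      ring₁ = solve-∀
      ring₂ : ∀ Y A A' U U' s → A - A' ≡ 1ℤ * (1ℤ * (Y - (A' + s * U')) + - 1ℤ * (Y - (A + s * U))) + 1ℤ * (- s * (U - U'))
      ring₂ = solve-∀
      dirs : ∀ {i} → i ℕ.< 1 ℕ.+ t → P ∣ dir x i - dir x' i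
      dirs {i} i< = [ (λ d → contradiction d s≢) , id ]′ (euclid pr (param y - param y') (dir x i - dir x' i)
        (∣-lin pr 1ℤ (- 1ℤ) (∣-lin pr 1ℤ (- 1ℤ) (i₂ i<) (i₁ i<) refl) (∣-lin pr 1ℤ (- 1ℤ) (i₄ i<) (i₃ i<) refl)
          (ring₁ (coord y i) (coord y' i) (coord x i) (coord x' i) (dir x i) (dir x' i) (param y) (param y'))))

    no-C₄ : ∀ {x x' y y'} → x ℕ.< #lines → x' ℕ.< #lines → y ℕ.< #points → y' ℕ.< #points →
      x ≢ x' → y ≢ y' → Inc x y → Inc x' y → Inc x y' → ¬ Inc x' y'
    no-C₄ x< x'< y< y'< x≢x' y≢y' i₁ i₂ i₃ i₄ =
      x≢x' (two-points x< x'< i₁ i₂ i₃ i₄ (y≢y' ∘ points-equal y< y'< i₁ i₃))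

    ∣normForm-normForm : ∀ l (u u' : ℕ → ℤ) → (∀ {i} → i ℕ.< 2 ℕ.+ l → P ∣ u i - u' i) →
                         P ∣ normForm α l u - normForm α l u'
    ∣normForm-normForm zero u u' h =
      ∣-lin pr (u 0 + u' 0) (- α * (u 1 + u' 1)) (h (s≤s z≤n)) (h (s≤s (s≤s z≤n))) (ring α (u 0) (u' 0) (u 1) (u' 1))
      where
      ring : ∀ α x x' y y' → x * x - α * (y * y) - (x' * x' - α * (y' * y')) ≡ (x + x') * (x - x') + - α * (y + y') * (y - y')
      ring = solve-∀
    ∣normForm-normForm (suc l) u u' h = ∣-lin pr 1ℤ 1ℤ
      (∣normForm-normForm l u u' (h ∘ ℕ.m≤n⇒m≤1+n))
      (∣-⇒∣^-^ pr (u (2 ℕ.+ l)) (u' (2 ℕ.+ l)) (3 ℕ.+ l) (h ℕ.≤-refl))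
      (ring (normForm α l u) (normForm α l u') (u (2 ℕ.+ l) ^ (3 ℕ.+ l)) (u' (2 ℕ.+ l) ^ (3 ℕ.+ l)))
      where
      ring : ∀ a a' b b' → a + b - (a' + b') ≡ 1ℤ * (a - a') + 1ℤ * (b - b')
      ring = solve-∀

    -- The slopes of the lines through y that meet x lie on a line u + r w with r = 1 / (sᵢ - s₀);
    -- the norm form would agree with an affine function of r at t + 1 places.
    no-θ₃ : ∀ {x y} (Y L : Fin t → ℕ) → x ℕ.< #lines → y ℕ.< #points →
      (∀ i → Y i ℕ.< #points) → (∀ i → L i ℕ.< #lines) →
      (∀ {i j} → Y i ≡ Y j → i ≡ j) → (∀ i → Y i ≢ y) → (∀ i → L i ≢ x) →
      (∀ i → Inc x (Y i)) → (∀ i → Inc (L i) (Y i)) → ¬ (∀ i → Inc (L i) y)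
    no-θ₃ {x} {y} Y L x< y< Y< L< Y-inj Y≢y L≢x xY LY Ly = L≢x zero (lines-equal (L< zero) x< coords-agree slopes-agree)
      where
      s₀ = param y
      s : Fin t → ℤ
      s i = param (Y i)
      s≢s₀ : ∀ i → ¬ (P ∣ s i - s₀)
      s≢s₀ i d = Y≢y i (points-equal (Y< i) y< (LY i) (Ly i) d)
      r : Fin (suc t) → ℤ
      -- The value 0 stands for the line x itself; with the t lines `L i` it makes t + 1 roots.
      r zero    = 0ℤ
      r (suc i) = proj₁ (inverse pr (s i - s₀) (s≢s₀ i))
      r-inv : ∀ i → P ∣ r (suc i) * (s i - s₀) - 1ℤ
      r-inv i = proj₂ (inverse pr (s i - s₀) (s≢s₀ i))
      r≢0 : ∀ i → ¬ (P ∣ r (suc i))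
      r≢0 i d = ∤1 pr (∣-lin pr (s i - s₀) (- 1ℤ) d (r-inv i) (ring (r (suc i)) (s i - s₀)))
        where
        ring : ∀ r d → 1ℤ ≡ d * r + - 1ℤ * (r * d - 1ℤ)
        ring = solve-∀
      r-distinct : Distinct pr r
      r-distinct zero    zero    0≢0 d = 0≢0 refl
      r-distinct zero    (suc j) _ d = r≢0 j (∣-mul pr (- 1ℤ) d (ring (r (suc j))))
        where
        ring : ∀ r → r ≡ - 1ℤ * (0ℤ - r)
        ring = solve-∀
      r-distinct (suc i) zero    _ d = r≢0 i (∣-mul pr 1ℤ d (ring (r (suc i))))
        where
        ring : ∀ r → r ≡ 1ℤ * (r - 0ℤ)
        ring = solve-∀
      -- The inverse of sᵢ - s₀ determines sᵢ, and on the common line x of the points `Y i` the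
      -- parameter determines the point.
      r-distinct (suc i) (suc j) i≢j d = i≢j (cong suc (Y-inj (points-equal (Y< i) (Y< j) (xY i) (xY j)
        (∣-lin pr (- ((s i - s₀) * (s j - s₀))) 1ℤ d (∣-lin pr (- (s i - s₀)) (s j - s₀) (r-inv j) (r-inv i) refl)
          (ring (s i) (s j) s₀ (r (suc i)) (r (suc j)))))))
        where
        ring : ∀ a b c r r' → a - b ≡ - ((a - c) * (b - c)) * (r - r') + 1ℤ * (- (a - c) * (r' * (b - c) - 1ℤ) + (b - c) * (r * (a - c) - 1ℤ))
        ring = solve-∀
      -- The displacement from y to the point of x with the same parameter s₀. Eliminating `Y i` and
      -- the base point of `L i` from the incidences gives (sᵢ - s₀)(dir (L i) - dir x) ≡ w.
      w : ℕ → ℤ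
      w j = coord x j - coord y j + s₀ * dir x j
      dir-L : ∀ i {j} → j ℕ.< 1 ℕ.+ t → P ∣ dir x j + r (suc i) * w j - dir (L i) j
      dir-L i {j} j< = ∣-lin pr (r (suc i)) (dir (L i) j - dir x j)
        (∣-lin pr 1ℤ 1ℤ (∣-lin pr 1ℤ (- 1ℤ) (LY i j<) (xY i j<) refl) (∣-mul pr (- 1ℤ) (Ly i j<) refl) refl)
        (r-inv i)
        (ring (coord x j) (coord (L i) j) (coord y j) (coord (Y i) j) (dir x j) (dir (L i) j) (s i) s₀ (r (suc i)))
        where
        ring : ∀ A A' Y Y' U U' s s₀ r → U + r * (A - Y + s₀ * U) - U' ≡
          r * (1ℤ * (1ℤ * (Y' - (A' + s * U')) + - 1ℤ * (Y' - (A + s * U))) + 1ℤ * (- 1ℤ * (Y - (A' + s₀ * U')))) + (U' - U) * (r * (s - s₀) - 1ℤ)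
        ring = solve-∀
      slope-L : ∀ i {j} → j ℕ.< t → P ∣ slope x j + r (suc i) * w j - slope (L i) j
      slope-L i {j} j<t = subst₂ (λ a b → P ∣ a + r (suc i) * w j - b) (dir-< x j<t) (dir-< (L i) j<t) (dir-L i (ℕ.m≤n⇒m≤1+n j<t))
      norm-L : ∀ i → P ∣ normForm α k (slope x) + r (suc i) * w t - normForm α k (slope (L i))
      norm-L i = subst₂ (λ a b → P ∣ a + r (suc i) * w t - b) (dir-t x) (dir-t (L i)) (dir-L i ℕ.≤-refl)
      roots : ∀ i → P ∣ normForm α k (λ j → slope x j + r i * w j) - normForm α k (slope x) - r i * w t
      roots zero = ∣-mul pr 1ℤ (∣normForm-normForm k (λ j → slope x j + 0ℤ * w j) (slope x) (λ {j} _ → subst (P ∣_) (ring₁ (slope x j) (w j)) (∣0 pr)))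
                     (ring₂ (normForm α k (λ j → slope x j + 0ℤ * w j)) (normForm α k (slope x)) (w t))
        where
        ring₁ : ∀ u w → 0ℤ ≡ u + 0ℤ * w - u
        ring₁ = solve-∀
        ring₂ : ∀ a b w → a - b - 0ℤ * w ≡ 1ℤ * (a - b)
        ring₂ = solve-∀
      roots (suc i) = ∣-lin pr 1ℤ (- 1ℤ) (∣normForm-normForm k (λ j → slope x j + r (suc i) * w j) (slope (L i)) (slope-L i)) (norm-L i)
        (ring (normForm α k (λ j → slope x j + r (suc i) * w j)) (normForm α k (slope x)) (normForm α k (slope (L i))) (r (suc i) * w t))
        where
        ring : ∀ a b c w → a - b - w ≡ 1ℤ * (a - c) + - 1ℤ * (b + w - c)
        ring = solve-∀
      -- The last coordinate `w t` is the slope of the affine function that the norm form would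
      -- follow.
      w≡0 : ∀ j → j ℕ.< t → P ∣ w j
      w≡0 = normForm-line pr an k (slope x) w (w t) r r-distinct roots
      slopes-agree : ∀ {j} → j ℕ.< t → P ∣ slope (L zero) j - slope x j
      slopes-agree {j} j<t = ∣-lin pr (- 1ℤ) (r (suc zero)) (slope-L zero j<t) (w≡0 j j<t)
        (ring (slope (L zero) j) (slope x j) (r (suc zero)) (w j))
        where
        ring : ∀ a b r w → a - b ≡ - 1ℤ * (b + r * w - a) + r * w
        ring = solve-∀
      dirs-agree : ∀ {j} → j ℕ.< 1 ℕ.+ t → P ∣ dir (L zero) j - dir x j
      dirs-agree {j} j< with ℕ.m≤n⇒m<n∨m≡n (ℕ.s≤s⁻¹ j<)
      ... | inj₁ j<t = subst₂ (λ a b → P ∣ a - b) (sym (dir-< (L zero) j<t)) (sym (dir-< x j<t)) (slopes-agree j<t)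
      ... | inj₂ refl = subst₂ (λ a b → P ∣ a - b) (sym (dir-t (L zero))) (sym (dir-t x))
                          (∣normForm-normForm k (slope (L zero)) (slope x) slopes-agree)
      coords-agree : ∀ {j} → j ℕ.< 1 ℕ.+ t → P ∣ coord (L zero) j - coord x j
      coords-agree {j} j< = ∣-lin pr 1ℤ (- s zero) (∣-lin pr 1ℤ (- 1ℤ) (xY zero j<) (LY zero j<) refl) (dirs-agree j<)
        (ring (coord (L zero) j) (coord x j) (coord (Y zero) j) (dir (L zero) j) (dir x j) (s zero))
        where
        ring : ∀ A' A Y U' U s → A' - A ≡ 1ℤ * (1ℤ * (Y - (A + s * U)) + - 1ℤ * (Y - (A' + s * U'))) + - s * (U' - U)
        ring = solve-∀

    pointDigit : ℕ → Fin p → ℕ → ℕ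
    pointDigit x s i = if does (i ℕ.<? 1 ℕ.+ t)
      then toℕ (proj₁ (residue pr (coord x i + + toℕ s * dir x i))) else toℕ s

    pointDigit< : ∀ x s i → pointDigit x s i ℕ.< p
    pointDigit< x s i with does (i ℕ.<? 1 ℕ.+ t)
    ... | true  = Fin.toℕ<n _
    ... | false = Fin.toℕ<n s

    point : ℕ → Fin p → ℕ
    point x s = fromDigits p (2 ℕ.+ t) (pointDigit x s)

    point< : ∀ x s → point x s ℕ.< #points
    point< x s = fromDigits< p (2 ℕ.+ t) (pointDigit x s) (pointDigit< x s)

    param-point : ∀ x s → digit p (point x s) (1 ℕ.+ t) ≡ toℕ s
    param-point x s = trans (digit-fromDigits p (2 ℕ.+ t) (pointDigit x s) (pointDigit< x s) (1 ℕ.+ t) ℕ.≤-refl)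
      (cong (λ b → if b then toℕ (proj₁ (residue pr (coord x (1 ℕ.+ t) + + toℕ s * dir x (1 ℕ.+ t)))) else toℕ s)
        (dec-false (1 ℕ.+ t ℕ.<? 1 ℕ.+ t) (ℕ.<-irrefl refl)))

    point-injective : ∀ x {s s'} → point x s ≡ point x s' → s ≡ s'
    point-injective x {s} {s'} eq = Fin.toℕ-injective
      (trans (sym (param-point x s)) (trans (cong (λ y → digit p y (1 ℕ.+ t)) eq) (param-point x s')))

    inc-point : ∀ x s → Inc x (point x s)
    inc-point x s {i} i< = subst₂ (λ a b → P ∣ + a - (coord x i + + b * dir x i)) (sym digit≡) (sym (param-point x s))
      (∣-mul pr (- 1ℤ) (proj₂ res) (ring (+ toℕ (proj₁ res)) (coord x i + + toℕ s * dir x i)))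
      where
      res = residue pr (coord x i + + toℕ s * dir x i)
      digit≡ : digit p (point x s) i ≡ toℕ (proj₁ res)
      digit≡ = trans (digit-fromDigits p (2 ℕ.+ t) (pointDigit x s) (pointDigit< x s) i (ℕ.m≤n⇒m≤1+n i<))
        (cong (λ b → if b then toℕ (proj₁ res) else toℕ s) (dec-true (i ℕ.<? 1 ℕ.+ t) i<))
      ring : ∀ a b → a - b ≡ - 1ℤ * (b - a)
      ring = solve-∀

-- From an incidence relation to a bipartite graph free of C₄ and θ₃.

module IncidenceGraphs where

  open import Defs
  open Graph
  open import Data.Bool using (false; T; _∨_)
  open import Data.Unit using (tt)
  open import Data.Nat as ℕ using (ℕ; zero; suc; s≤s; z≤n; _≤_; _<_; _*_)
  import Data.Nat.Properties as ℕ
  open import Data.Fin as Fin using (Fin; zero; suc; toℕ; fromℕ<)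
  open import Data.Fin.Patterns using (0F; 1F; 2F; 3F)
  import Data.Fin.Properties as Fin
  open import Data.Fin.Subset using (Subset; ∣_∣; _∈_; _-_)
  open import Data.Fin.Subset.Properties using (x∈p∧x≢y⇒x∈p-y; x∈p⇒∣p-x∣<∣p∣)
  open import Data.List using ([]; _∷_)
  open import Data.List.Relation.Unary.All using ([]; _∷_)
  open import Data.Product using (∃-syntax; _×_; _,_; proj₁; proj₂)
  open import Data.Sum using (inj₁; inj₂)
  open import Data.Vec as Vec using (Vec; lookup; tabulate)
  open import Data.Vec.Properties using (lookup∘tabulate; lookup⇒[]=)
  open import Relation.Binary.PropositionalEquality
  open import Relation.Nullary using (¬_; Dec; yes; contradiction; does; _×-dec_)
  open import Relation.Nullary.Decidable using (dec-true)
  open import Function using (_∘_; Injective)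

  does⇒ : ∀ {A : Set} (a? : Dec A) → T (does a?) → A
  does⇒ (yes a) _ = a

  near-far : ∀ {t} i → T (adj (θ₃ t) (near i) (far i))
  near-far i = subst (λ b → T (b ∨ false)) (sym (dec-true (i Fin.≟ i) refl)) tt

  far-near : ∀ {t} i → T (adj (θ₃ t) (far i) (near i))
  far-near i = subst T (sym (dec-true (i Fin.≟ i) refl)) tt

  near-injective : ∀ {t} {i j : Fin t} → _≡_ {A = ΘVertex t} (near i) (near j) → i ≡ j
  near-injective refl = refl

  far-injective : ∀ {t} {i j : Fin t} → _≡_ {A = ΘVertex t} (far i) (far j) → i ≡ j
  far-injective refl = refl

  injection⇒≤∣∣ : ∀ {k n} (S : Subset n) (g : Fin k → Fin n) → Injective _≡_ _≡_ g →
                  (∀ i → g i ∈ S) → k ≤ ∣ S ∣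
  injection⇒≤∣∣ {zero}  S g g-inj g∈S = z≤n
  injection⇒≤∣∣ {suc k} S g g-inj g∈S = ℕ.≤-trans
    (s≤s (injection⇒≤∣∣ (S - g zero) (g ∘ suc) (Fin.suc-injective ∘ g-inj)
      (λ i → x∈p∧x≢y⇒x∈p-y (g∈S (suc i)) (λ eq → Fin.0≢1+n (sym (g-inj eq))))))
    (x∈p⇒∣p-x∣<∣p∣ (g∈S zero))

  sum-tabulate-≥ : ∀ {n b} N k (f : Fin n → Subset b) → N ≤ n → (∀ i → toℕ i < N → k ≤ ∣ f i ∣) →
                   N * k ≤ Vec.sum (Vec.map ∣_∣ (tabulate f))
  sum-tabulate-≥ zero    k f N≤n f≥ = z≤n
  sum-tabulate-≥ {suc n} (suc N) k f (s≤s N≤n) f≥ =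
    ℕ.+-mono-≤ (f≥ zero (s≤s z≤n)) (sum-tabulate-≥ N k (f ∘ suc) N≤n (λ i → f≥ (suc i) ∘ s≤s))

  -- The relation on {0 , … , N - 1} × {0 , … , M - 1} is padded with isolated vertices.
  module _ {N M n m : ℕ} (N≤n : N ≤ n) (M≤m : M ≤ m)
           {Inc : ℕ → ℕ → Set} (inc? : ∀ x y → Dec (Inc x y)) where

    private
      Edge : Fin n → Fin m → Set
      Edge i j = (toℕ i < N) × (toℕ j < M) × Inc (toℕ i) (toℕ j)

      edge? : ∀ i j → Dec (Edge i j)
      edge? i j = (toℕ i ℕ.<? N) ×-dec (toℕ j ℕ.<? M) ×-dec inc? (toℕ i) (toℕ j)

      row : Fin n → Subset m
      row i = tabulate (λ j → does (edge? i j))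

      G : Bipartite n m
      G = tabulate row

      lookup-G : ∀ i j → lookup (lookup G i) j ≡ does (edge? i j)
      lookup-G i j = trans (cong (λ S → lookup S j) (lookup∘tabulate row i)) (lookup∘tabulate _ j)

      T⇒edge : ∀ i j → T (lookup (lookup G i) j) → Edge i j
      T⇒edge i j h = does⇒ (edge? i j) (subst T (lookup-G i j) h)

      left-step : ∀ {u i} v → u ≡ inj₁ i → T (adj ⟦ G ⟧ u v) → ∃[ j ] (v ≡ inj₂ j × Edge i j)
      left-step {i = i} (inj₂ j) refl h = j , refl , T⇒edge i j h

      right-step : ∀ {u j} v → u ≡ inj₂ j → T (adj ⟦ G ⟧ u v) → ∃[ i ] (v ≡ inj₁ i × Edge i j)
      right-step {j = j} (inj₁ i) refl h = i , refl , T⇒edge i j h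

      edges≥ : ∀ {k} (g : ℕ → Fin k → ℕ) → (∀ x s → g x s < M) → (∀ x → Injective _≡_ _≡_ (g x)) →
               (∀ x s → Inc x (g x s)) → N * k ≤ #edges G
      edges≥ {k} g g<M g-inj g-inc = sum-tabulate-≥ N k row N≤n λ i i<N →
        injection⇒≤∣∣ (row i) (λ s → fromℕ< (g<m (toℕ i) s))
          (λ eq → g-inj (toℕ i) (Fin.fromℕ<-injective _ _ _ _ eq))
          (λ s → lookup⇒[]= _ _ (trans (lookup∘tabulate _ (fromℕ< (g<m (toℕ i) s)))
            (dec-true (edge? i _) (i<N ,
              subst (_< M) (sym (Fin.toℕ-fromℕ< (g<m (toℕ i) s))) (g<M (toℕ i) s) ,
              subst (Inc (toℕ i)) (sym (Fin.toℕ-fromℕ< (g<m (toℕ i) s))) (g-inc (toℕ i) s)))))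
        where
        g<m : ∀ x s → g x s < m
        g<m x s = ℕ.<-≤-trans (g<M x s) M≤m

    module _ (no-C₄ : ∀ {x x' y y'} → x < N → x' < N → y < M → y' < M → x ≢ x' → y ≢ y' →
                      Inc x y → Inc x' y → Inc x y' → ¬ Inc x' y') where
      private
        -- The cycle may be taken to start on the left; otherwise `C₄-free` rotates it by one
        -- vertex.
        C₄-free-left : ∀ {a b c d i} → a ≡ inj₁ i → a ≢ c → b ≢ d → T (adj ⟦ G ⟧ a b) → T (adj ⟦ G ⟧ b c) →
                       T (adj ⟦ G ⟧ a d) → ¬ T (adj ⟦ G ⟧ c d)
        C₄-free-left {b = b} {c} {d} refl a≢c b≢d ab bc ad cd with left-step b refl ab | left-step d refl ad
        ... | j , refl , (i< , j< , p) | j' , refl , (_ , j'< , q) with right-step c refl bc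
        ...   | i' , refl , (i'< , _ , r) with left-step d refl cd
        ...     | _ , refl , (_ , _ , s) = no-C₄ i< i'< j< j'<
                    (a≢c ∘ cong inj₁ ∘ Fin.toℕ-injective) (b≢d ∘ cong inj₂ ∘ Fin.toℕ-injective) p r q s

        C₄-free : ¬ (C₄ ⊑ ⟦ G ⟧)
        C₄-free (f , inj , hom) with f 0F in e₀
        ... | inj₁ i = C₄-free-left e₀ (0F≢2F ∘ inj) (1F≢3F ∘ inj) (hom 0F 1F tt) (hom 1F 2F tt) (hom 0F 3F tt) (hom 2F 3F tt)
          where
          0F≢2F : 0F ≢ 2F
          0F≢2F ()
          1F≢3F : 1F ≢ 3F
          1F≢3F ()
        ... | inj₂ j with right-step (f 1F) e₀ (hom 0F 1F tt)
        ...   | _ , e₁ , _ = C₄-free-left e₁ (1F≢3F ∘ inj) (2F≢0F ∘ inj) (hom 1F 2F tt) (hom 2F 3F tt) (hom 1F 0F tt) (hom 3F 0F tt)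
          where
          1F≢3F : 1F ≢ 3F
          1F≢3F ()
          2F≢0F : 2F ≢ 0F
          2F≢0F ()

      module _ {t : ℕ} (0<t : 0 < t)
        (no-θ₃ : ∀ {x y} (Y L : Fin t → ℕ) → x < N → y < M → (∀ i → Y i < M) → (∀ i → L i < N) →
          (∀ {i j} → Y i ≡ Y j → i ≡ j) → (∀ i → Y i ≢ y) → (∀ i → L i ≢ x) →
          (∀ i → Inc x (Y i)) → (∀ i → Inc (L i) (Y i)) → ¬ (∀ i → Inc (L i) y)) where
        private
          θ₃-free-left : ∀ {a b x} (ν φ : Fin t → Vertex ⟦ G ⟧) → a ≡ inj₁ x →
            Injective _≡_ _≡_ ν → (∀ i → ν i ≢ b) → (∀ i → φ i ≢ a) →
            (∀ i → T (adj ⟦ G ⟧ a (ν i))) → (∀ i → T (adj ⟦ G ⟧ (ν i) (φ i))) → ¬ (∀ i → T (adj ⟦ G ⟧ (φ i) b))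
          θ₃-free-left {b = b} {x} ν φ refl ν-inj ν≢b φ≢a aν νφ φb =
            no-θ₃ (toℕ ∘ Y) (toℕ ∘ L) (proj₁ (xY one)) (proj₁ (proj₂ (Ly one)))
              (λ i → proj₁ (proj₂ (xY i))) (λ i → proj₁ (LY i))
              (λ eq → ν-inj (trans (eY _) (trans (cong inj₂ (Fin.toℕ-injective eq)) (sym (eY _)))))
              (λ i eq → ν≢b i (trans (eY i) (trans (cong inj₂ (Fin.toℕ-injective eq)) (sym ey))))
              (λ i eq → φ≢a i (trans (eL i) (cong inj₁ (Fin.toℕ-injective eq))))
              (λ i → proj₂ (proj₂ (xY i))) (λ i → proj₂ (proj₂ (LY i))) (λ i → proj₂ (proj₂ (Ly i)))
            where
            one : Fin t
            one = fromℕ< 0<t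
            stepY : ∀ i → ∃[ j ] (ν i ≡ inj₂ j × Edge x j)
            stepY i = left-step (ν i) refl (aν i)
            Y : Fin t → Fin m
            Y = proj₁ ∘ stepY
            eY : ∀ i → ν i ≡ inj₂ (Y i)
            eY i = proj₁ (proj₂ (stepY i))
            xY : ∀ i → Edge x (Y i)
            xY i = proj₂ (proj₂ (stepY i))
            stepL : ∀ i → ∃[ l ] (φ i ≡ inj₁ l × Edge l (Y i))
            stepL i = right-step (φ i) (eY i) (νφ i)
            L : Fin t → Fin n
            L = proj₁ ∘ stepL
            eL : ∀ i → φ i ≡ inj₁ (L i)
            eL i = proj₁ (proj₂ (stepL i))
            LY : ∀ i → Edge (L i) (Y i)
            LY i = proj₂ (proj₂ (stepL i))
            stepy : ∀ i → ∃[ j ] (b ≡ inj₂ j × Edge (L i) j)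
            stepy i = left-step b (eL i) (φb i)
            y : Fin m
            y = proj₁ (stepy one)
            ey : b ≡ inj₂ y
            ey = proj₁ (proj₂ (stepy one))
            Ly : ∀ i → Edge (L i) y
            Ly i with stepy i
            ... | j , ej , e with trans (sym ej) ey
            ...   | refl = e

          θ₃-free : ¬ (θ₃ t ⊑ ⟦ G ⟧)
          θ₃-free (f , inj , hom) with f source in e₀
          ... | inj₁ x = θ₃-free-left (λ i → f (near i)) (λ i → f (far i)) e₀ (near-injective ∘ inj)
                (λ i eq → contradiction (inj eq) λ ()) (λ i eq → contradiction (inj eq) λ ())
                (λ i → hom source (near i) tt) (λ i → hom (near i) (far i) (near-far i)) (λ i → hom (far i) target tt)
          -- The ends of a 3-edge path lie in different parts, so here the target is on the left,
          -- and the theta graph is read backwards with `near` and `far` exchanged.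
          ... | inj₂ y with right-step (f (near (fromℕ< 0<t))) e₀ (hom source (near (fromℕ< 0<t)) tt)
          ...   | _ , e₁ , _ with left-step (f (far (fromℕ< 0<t))) e₁ (hom (near (fromℕ< 0<t)) (far (fromℕ< 0<t)) (near-far (fromℕ< 0<t)))
          ...     | _ , e₂ , _ with right-step (f target) e₂ (hom (far (fromℕ< 0<t)) target tt)
          ...       | x , e₃ , _ = θ₃-free-left (λ i → f (far i)) (λ i → f (near i)) e₃ (far-injective ∘ inj)
                (λ i eq → contradiction (inj eq) λ ()) (λ i eq → contradiction (inj eq) λ ())
                (λ i → hom target (far i) tt) (λ i → hom (far i) (near i) (far-near i)) (λ i → hom (near i) source tt)

        incidence≤ex : ∀ {k} (g : ℕ → Fin k → ℕ) → (∀ x s → g x s < M) → (∀ x → Injective _≡_ _≡_ (g x)) →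
                       (∀ x s → Inc x (g x s)) → N * k ≤ ex n m (C₄ ∷ θ₃ t ∷ [])
        incidence≤ex g g<M g-inj g-inc =
          ℕ.≤-trans (edges≥ g g<M g-inj g-inc) (ex-upper _ G (C₄-free ∷ θ₃-free ∷ []))

-- The upper bound: counting paths with three edges.

module PathCounting where

  open import Defs
  open Graph
  open IncidenceGraphs using (does⇒)
  open import Data.Bool using (Bool; true; false; T; _∧_; not; if_then_else_)
  open import Data.Bool.Properties using (T?)
  open import Data.Unit using (tt)
  open import Data.Nat as ℕ using (ℕ; zero; suc; s≤s; z≤n; _≤_; _<_; _+_; _*_; _∸_)
  open import Data.Nat.Properties as ℕ
  open import Data.Nat.Tactic.RingSolver using (solve-∀)
  open import Algebra.Properties.Semiring.Sum ℕ.+-*-semiring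
    using (sum; sum-cong-≗; ∑-distrib-+; ∑-comm; *-distribˡ-sum; *-distribʳ-sum)
  open import Data.Fin as Fin using (Fin; zero; suc)
  open import Data.Fin.Patterns using (0F; 1F; 2F; 3F)
  import Data.Fin.Properties as Fin
  open import Data.Fin.Subset using (Subset; ∣_∣)
  open import Data.List using ([]; _∷_)
  open import Data.List.Relation.Unary.All using ([]; _∷_)
  open import Relation.Unary using (Decidable)
  open import Data.Product using (∃-syntax; _×_; _,_; proj₁; proj₂)
  open import Data.Sum using (_⊎_; inj₁; inj₂)
  open import Data.Vec using (lookup; []; _∷_)
  open import Relation.Binary.PropositionalEquality
  open import Relation.Nullary using (¬_; Dec; yes; no; contradiction; does)
  open import Function using (_∘_; Injective)

  ind : Bool → ℕ
  ind b = if b then 1 else 0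

  sum-mono : ∀ {n} {f g : Fin n → ℕ} → (∀ i → f i ≤ g i) → sum f ≤ sum g
  sum-mono {zero}  f≤g = z≤n
  sum-mono {suc n} f≤g = +-mono-≤ (f≤g zero) (sum-mono (f≤g ∘ suc))

  sum-≤ : ∀ {n c} {f : Fin n → ℕ} → (∀ i → f i ≤ c) → sum f ≤ n * c
  sum-≤ {zero}  f≤c = z≤n
  sum-≤ {suc n} f≤c = +-mono-≤ (f≤c zero) (sum-≤ (f≤c ∘ suc))

  *-sum-sum : ∀ {m n} c (f : Fin m → ℕ) (g : Fin n → ℕ) →
              c * (sum f * sum g) ≡ sum (λ i → sum (λ j → c * (f j * g i)))
  *-sum-sum c f g = begin
    c * (sum f * sum g)                          ≡⟨ cong (c *_) (*-distribˡ-sum (sum f) g) ⟩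
    c * sum (λ i → sum f * g i)                  ≡⟨ *-distribˡ-sum c (λ i → sum f * g i) ⟩
    sum (λ i → c * (sum f * g i))                ≡⟨ sum-cong-≗ (λ i → trans (cong (c *_) (*-distribʳ-sum (g i) f)) (*-distribˡ-sum c (λ j → f j * g i))) ⟩
    sum (λ i → sum (λ j → c * (f j * g i))) ∎
    where open ≡-Reasoning

  extract : ∀ {n} k (f : Fin n → Bool) → k ≤ sum (ind ∘ f) →
            ∃[ g ] (Injective _≡_ _≡_ g × (∀ (i : Fin k) → T (f (g i))))
  extract zero f _ = (λ ()) , (λ { {()} }) , λ ()
  extract {suc n} (suc k) f k≤ with f zero in eq
  ... | false with extract (suc k) (f ∘ suc) k≤
  ...   | g , g-inj , fg = suc ∘ g , g-inj ∘ Fin.suc-injective , fg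
  extract {suc n} (suc k) f (s≤s k≤) | true with extract k (f ∘ suc) k≤
  ...   | g , g-inj , fg = h , h-inj , λ { zero → subst T (sym eq) tt ; (suc i) → fg i }
    where
    h : Fin (suc k) → Fin (suc n)
    h zero    = zero
    h (suc i) = suc (g i)
    h-inj : Injective _≡_ _≡_ h
    h-inj {zero}  {zero}  _ = refl
    h-inj {suc i} {suc j} e = cong suc (g-inj (Fin.suc-injective e))

  sum-unique : ∀ {n} (f : Fin n → Bool) → (∀ {i j} → T (f i) → T (f j) → i ≡ j) →
               sum (ind ∘ f) ≤ ind (does (Fin.any? (T? ∘ f)))
  sum-unique f uniq with Fin.any? (T? ∘ f)
  ... | yes _ = ≮⇒≥ λ 2≤ → let g , g-inj , fg = extract 2 f 2≤ in
                  contradiction (g-inj (uniq (fg zero) (fg (suc zero)))) λ ()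
  ... | no ¬∃ = ≮⇒≥ λ 1≤ → let g , _ , fg = extract 1 f 1≤ in ¬∃ (g zero , fg zero)

  sum-δ : ∀ {n} (j : Fin n) → sum (λ j' → ind (does (j Fin.≟ j'))) ≤ 1
  sum-δ j = ≮⇒≥ λ 2≤ → let g , g-inj , fg = extract 2 (λ j' → does (j Fin.≟ j')) 2≤ in
    contradiction (g-inj (trans (sym (does⇒ (j Fin.≟ g zero) (fg zero))) (does⇒ (j Fin.≟ g (suc zero)) (fg (suc zero))))) λ ()

  ind-∧ : ∀ x y → ind (x ∧ y) ≡ ind x * ind y
  ind-∧ false _ = refl
  ind-∧ true  y = sym (+-identityʳ (ind y))

  sum-others : ∀ {n} (f : Fin n → Bool) j →
               sum (ind ∘ f) ∸ 1 ≤ sum (λ j' → ind (f j' ∧ not (does (j Fin.≟ j'))))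
  sum-others f j = ∸-monoˡ-≤ 1 (begin
    sum (ind ∘ f)                                                       ≤⟨ sum-mono (λ j' → pointwise (f j') (does (j Fin.≟ j'))) ⟩
    sum (λ j' → ind (does (j Fin.≟ j')) + ind (f j' ∧ not (does (j Fin.≟ j')))) ≡⟨ ∑-distrib-+ (λ j' → ind (does (j Fin.≟ j'))) _ ⟩
    sum (λ j' → ind (does (j Fin.≟ j'))) + sum (λ j' → ind (f j' ∧ not (does (j Fin.≟ j')))) ≤⟨ +-monoˡ-≤ _ (sum-δ j) ⟩
    suc (sum (λ j' → ind (f j' ∧ not (does (j Fin.≟ j'))))) ∎)
    where
    open ≤-Reasoning
    pointwise : ∀ x y → ind x ≤ ind y + ind (x ∧ not y)
    pointwise false _     = z≤n
    pointwise true  false = ≤-refl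
    pointwise true  true  = ≤-refl

  ∣∣≡sum : ∀ {n} (S : Subset n) → ∣ S ∣ ≡ sum (ind ∘ lookup S)
  ∣∣≡sum []          = refl
  ∣∣≡sum (true ∷ S)  = cong suc (∣∣≡sum S)
  ∣∣≡sum (false ∷ S) = ∣∣≡sum S

  #edges≡sum : ∀ {a b} (G : Bipartite a b) → #edges G ≡ sum (λ i → sum (λ j → ind (lookup (lookup G i) j)))
  #edges≡sum []      = refl
  #edges≡sum (S ∷ G) = cong₂ _+_ (∣∣≡sum S) (#edges≡sum G)

  module _ {a b : ℕ} (G : Bipartite a b) where

    private
      E : Fin a → Fin b → Bool
      E i j = lookup (lookup G i) j

    C₄-embedding : ∀ {i i' j j'} → i ≢ i' → j ≢ j' → T (E i j) → T (E i' j) → T (E i j') → T (E i' j') → C₄ ⊑ ⟦ G ⟧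
    C₄-embedding {i} {i'} {j} {j'} i≢i' j≢j' ij i'j ij' i'j' = f , inj , hom
      where
      f : Fin 4 → Fin a ⊎ Fin b
      f 0F = inj₁ i
      f 1F = inj₂ j
      f 2F = inj₁ i'
      f 3F = inj₂ j'
      inj : Injective _≡_ _≡_ f
      inj {0F} {0F} _ = refl
      inj {1F} {1F} _ = refl
      inj {2F} {2F} _ = refl
      inj {3F} {3F} _ = refl
      inj {0F} {2F} refl = contradiction refl i≢i'
      inj {2F} {0F} refl = contradiction refl i≢i'
      inj {1F} {3F} refl = contradiction refl j≢j'
      inj {3F} {1F} refl = contradiction refl j≢j'
      inj {0F} {3F} ()
      inj {2F} {3F} ()
      hom : ∀ u v → T (adj C₄ u v) → T (adj ⟦ G ⟧ (f u) (f v))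
      hom 0F 1F _ = ij
      hom 1F 0F _ = ij
      hom 1F 2F _ = i'j
      hom 2F 1F _ = i'j
      hom 2F 3F _ = i'j'
      hom 3F 2F _ = i'j'
      hom 3F 0F _ = ij'
      hom 0F 3F _ = ij'
      hom 1F 3F ()
      hom 3F 3F ()

    θ₃-embedding : ∀ {t i' j'} (x : Fin t → Fin a) (y : Fin t → Fin b) → Injective _≡_ _≡_ x → Injective _≡_ _≡_ y →
      (∀ k → x k ≢ i') → (∀ k → y k ≢ j') →
      (∀ k → T (E i' (y k))) → (∀ k → T (E (x k) (y k))) → (∀ k → T (E (x k) j')) → θ₃ t ⊑ ⟦ G ⟧
    θ₃-embedding {t} {i'} {j'} x y x-inj y-inj x≢ y≢ i'y xy xj' = f , inj , hom
      where
      f : ΘVertex t → Fin a ⊎ Fin b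
      f source   = inj₁ i'
      f target   = inj₂ j'
      f (near k) = inj₂ (y k)
      f (far k)  = inj₁ (x k)
      inj₁-inj : ∀ {i i'} → _≡_ {A = Fin a ⊎ Fin b} (inj₁ i) (inj₁ i') → i ≡ i'
      inj₁-inj refl = refl
      inj₂-inj : ∀ {j j'} → _≡_ {A = Fin a ⊎ Fin b} (inj₂ j) (inj₂ j') → j ≡ j'
      inj₂-inj refl = refl
      inj : Injective _≡_ _≡_ f
      inj {source} {source} _ = refl
      inj {target} {target} _ = refl
      inj {near k} {near l} e = cong (λ k → near k) (y-inj (inj₂-inj e))
      inj {far k}  {far l}  e = cong (λ k → far k) (x-inj (inj₁-inj e))
      inj {source} {far k}  e = contradiction (sym (inj₁-inj e)) (x≢ k)
      inj {far k}  {source} e = contradiction (inj₁-inj e) (x≢ k)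
      inj {target} {near k} e = contradiction (sym (inj₂-inj e)) (y≢ k)
      inj {near k} {target} e = contradiction (inj₂-inj e) (y≢ k)
      inj {source} {target} ()
      inj {source} {near k} ()
      inj {target} {source} ()
      inj {target} {far k}  ()
      inj {near k} {source} ()
      inj {near k} {far l}  ()
      inj {far k}  {target} ()
      inj {far k}  {near l} ()
      middle : ∀ k l → T (does (k Fin.≟ l)) → T (E (x l) (y k))
      middle k l h with does⇒ (k Fin.≟ l) h
      ... | refl = xy k
      hom : ∀ u v → T (adj (θ₃ t) u v) → T (adj ⟦ G ⟧ (f u) (f v))
      hom source   (near k) _ = i'y k
      hom (near k) source   _ = i'y k
      hom (far k)  target   _ = xj' k
      hom target   (far k)  _ = xj' k
      hom (near k) (far l)  h with does (k Fin.≟ l) in eq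
      ... | true = middle k l (subst T (sym eq) tt)
      hom (far l)  (near k) h = middle k l h
      hom source   source   ()
      hom source   target   ()
      hom source   (far _)  ()
      hom target   source   ()
      hom target   target   ()
      hom target   (near _) ()
      hom (near _) target   ()
      hom (near _) (near _) ()
      hom (far _)  source   ()
      hom (far _)  (far _)  ()

    module _ {t : ℕ} (C₄-free : ¬ (C₄ ⊑ ⟦ G ⟧)) (θ₃-free : ¬ (θ₃ t ⊑ ⟦ G ⟧)) where

      private
        path : Fin a → Fin b → Fin a → Fin b → Bool
        path i j i' j' = E i j ∧ ((E i j' ∧ not (does (j Fin.≟ j'))) ∧ (E i' j ∧ not (does (i Fin.≟ i'))))

        path⇒ : ∀ {i j i' j'} → T (path i j i' j') → T (E i j) × T (E i j') × j ≢ j' × T (E i' j) × i ≢ i'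
        path⇒ {i} {j} {i'} {j'} h with E i j | E i j' | E i' j | j Fin.≟ j' | i Fin.≟ i' | h
        ... | true | true | true | no j≢j' | no i≢i' | _ = tt , tt , j≢j' , tt , i≢i'

        few-paths : ∀ i' j' → sum (λ i → sum (λ j → ind (path i j i' j'))) ≤ t
        few-paths i' j' = <⇒≤ (≰⇒> λ t≤ →
          -- By `unique` the vertex i determines j, so the paths can be counted by i alone and t
          -- distinct such vertices extracted; `y-inj` gives the converse dependence.
          let g , g-inj , hg = extract t (λ i → does (Fin.any? (λ j → T? (path i j i' j'))))
                                 (≤-trans t≤ (sum-mono λ i → sum-unique (λ j → path i j i' j') (unique i)))
              w = λ k → does⇒ (Fin.any? (λ j → T? (path (g k) j i' j'))) (hg k)
              y = λ k → proj₁ (w k)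
              p = λ k → path⇒ (proj₂ (w k))
          in θ₃-free (θ₃-embedding g y g-inj (y-inj g g-inj y p)
               (λ k → proj₂ (proj₂ (proj₂ (proj₂ (p k))))) (λ k → proj₁ (proj₂ (proj₂ (p k))))
               (λ k → proj₁ (proj₂ (proj₂ (proj₂ (p k))))) (λ k → proj₁ (p k)) (λ k → proj₁ (proj₂ (p k)))))
          where
          unique : ∀ i {j₁ j₂} → T (path i j₁ i' j') → T (path i j₂ i' j') → j₁ ≡ j₂
          unique i {j₁} {j₂} h₁ h₂ with j₁ Fin.≟ j₂ | path⇒ h₁ | path⇒ h₂
          ... | yes eq | _ | _ = eq
          ... | no j₁≢j₂ | ij₁ , _ , _ , i'j₁ , i≢i' | ij₂ , _ , _ , i'j₂ , _ =
            contradiction (C₄-embedding i≢i' j₁≢j₂ ij₁ i'j₁ ij₂ i'j₂) C₄-free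
          y-inj : (g : Fin t → Fin a) → Injective _≡_ _≡_ g → (y : Fin t → Fin b) →
                  (∀ k → T (E (g k) (y k)) × T (E (g k) j') × y k ≢ j' × T (E i' (y k)) × g k ≢ i') →
                  Injective _≡_ _≡_ y
          y-inj g g-inj y p {k} {l} eq with k Fin.≟ l | p k | p l
          ... | yes k≡l | _ | _ = k≡l
          ... | no k≢l | ky , kj' , y≢j' , _ | ly , lj' , _ = contradiction
            (C₄-embedding (k≢l ∘ g-inj) y≢j' ky (subst (λ j → T (E (g l) j)) (sym eq) ly) kj' lj') C₄-free

      private
        degA : Fin a → ℕ
        degA i = sum (λ j → ind (E i j))

        degB : Fin b → ℕ
        degB j = sum (λ i → ind (E i j))

        ∑∑ : (Fin a → Fin b → ℕ) → ℕ
        ∑∑ f = sum (λ i → sum (f i))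

        ∑∑-mono : ∀ {f g} → (∀ i j → f i j ≤ g i j) → ∑∑ f ≤ ∑∑ g
        ∑∑-mono f≤g = sum-mono (λ i → sum-mono (f≤g i))

        ∑∑-+ : ∀ f g → ∑∑ (λ i j → f i j + g i j) ≡ ∑∑ f + ∑∑ g
        ∑∑-+ f g = trans (sum-cong-≗ (λ i → ∑-distrib-+ (f i) (g i))) (∑-distrib-+ (λ i → sum (f i)) (λ i → sum (g i)))

        ∑∑-* : ∀ c f → ∑∑ (λ i j → c * f i j) ≡ c * ∑∑ f
        ∑∑-* c f = trans (sum-cong-≗ (λ i → sym (*-distribˡ-sum c (f i)))) (sym (*-distribˡ-sum c (λ i → sum (f i))))

      -- Double counting of paths with three edges: by the middle edge, with one neighbour excluded
      -- at each of its ends, and by the pair of ends. The exchanges of sums move the ends i' and j'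
      -- outermost.
      ∑∑-paths : ∑∑ (λ i j → ind (E i j) * ((degA i ∸ 1) * (degB j ∸ 1))) ≤ a * (b * t)
      ∑∑-paths = begin
        ∑∑ (λ i j → ind (E i j) * ((degA i ∸ 1) * (degB j ∸ 1)))
          ≤⟨ ∑∑-mono (λ i j → *-monoʳ-≤ (ind (E i j)) (*-mono-≤ (sum-others (E i) j) (sum-others (λ i' → E i' j) i))) ⟩
        ∑∑ (λ i j → ind (E i j) * (sum (x i j) * sum (y i j)))
          ≡⟨ sum-cong-≗ (λ i → sum-cong-≗ (expand i)) ⟩
        sum (λ i → sum (λ j → sum (λ i' → sum (λ j' → ind (path i j i' j')))))
          ≡⟨ sum-cong-≗ (λ i → ∑-comm (λ j i' → sum (λ j' → ind (path i j i' j')))) ⟩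
        sum (λ i → sum (λ i' → sum (λ j → sum (λ j' → ind (path i j i' j')))))
          ≡⟨ ∑-comm (λ i i' → sum (λ j → sum (λ j' → ind (path i j i' j')))) ⟩
        sum (λ i' → sum (λ i → sum (λ j → sum (λ j' → ind (path i j i' j')))))
          ≡⟨ sum-cong-≗ (λ i' → sum-cong-≗ (λ i → ∑-comm (λ j j' → ind (path i j i' j')))) ⟩
        sum (λ i' → sum (λ i → sum (λ j' → sum (λ j → ind (path i j i' j')))))
          ≡⟨ sum-cong-≗ (λ i' → ∑-comm (λ i j' → sum (λ j → ind (path i j i' j')))) ⟩
        sum (λ i' → sum (λ j' → sum (λ i → sum (λ j → ind (path i j i' j')))))
          ≤⟨ sum-≤ (λ i' → sum-≤ (few-paths i')) ⟩
        a * (b * t) ∎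
        where
        open ≤-Reasoning
        x : Fin a → Fin b → Fin b → ℕ
        x i j j' = ind (E i j' ∧ not (does (j Fin.≟ j')))
        y : Fin a → Fin b → Fin a → ℕ
        y i j i' = ind (E i' j ∧ not (does (i Fin.≟ i')))
        expand : ∀ i j → ind (E i j) * (sum (x i j) * sum (y i j)) ≡ sum (λ i' → sum (λ j' → ind (path i j i' j')))
        expand i j = trans (*-sum-sum (ind (E i j)) (x i j) (y i j))
          (sum-cong-≗ λ i' → sum-cong-≗ λ j' → sym (trans (ind-∧ (E i j) ((E i j' ∧ not (does (j Fin.≟ j'))) ∧ (E i' j ∧ not (does (i Fin.≟ i')))))
            (cong (ind (E i j) *_) (ind-∧ (E i j' ∧ not (does (j Fin.≟ j'))) (E i' j ∧ not (does (i Fin.≟ i')))))))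

      private
        e = #edges G

        e≡∑degA : e ≡ sum degA
        e≡∑degA = #edges≡sum G

        e≡∑degB : e ≡ sum degB
        e≡∑degB = trans (#edges≡sum G) (∑-comm (λ i j → ind (E i j)))

        low : ℕ → ℕ → ℕ
        low n d = ind (does (4 * n * d ≤? e))

        low-≤ : ∀ n d → 4 * n * (low n d * d) ≤ e
        low-≤ n d = go (4 * n * d ≤? e)
          where
          go : (low? : Dec (4 * n * d ≤ e)) → 4 * n * (ind (does low?) * d) ≤ e
          go (yes le) = ≤-trans (≤-reflexive (cong (4 * n *_) (+-identityʳ d))) le
          go (no  _)  = ≤-trans (≤-reflexive (*-zeroʳ (4 * n))) z≤n

        ∑low-≤ : ∀ {n} (d : Fin n → ℕ) → 0 < n → 4 * sum (λ i → low n (d i) * d i) ≤ e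
        ∑low-≤ {n@(suc _)} d _ = *-cancelˡ-≤ n (begin
          n * (4 * sum (λ i → low n (d i) * d i))    ≡⟨ ring n (sum (λ i → low n (d i) * d i)) ⟩
          4 * n * sum (λ i → low n (d i) * d i)      ≡⟨ *-distribˡ-sum (4 * n) (λ i → low n (d i) * d i) ⟩
          sum (λ i → 4 * n * (low n (d i) * d i))    ≤⟨ sum-≤ (λ i → low-≤ n (d i)) ⟩
          n * e ∎)
          where
          open ≤-Reasoning
          ring : ∀ n s → n * (4 * s) ≡ 4 * n * s
          ring = solve-∀

        -- The source of the assumptions 4a ≤ e and 4b ≤ e: they force a degree d above a quarter of
        -- the average to be at least 2, whence d ≤ 2(d - 1) and the factor 4 becomes 8.
        high⇒ : ∀ n d → 4 * n ≤ e → ¬ (4 * n * d ≤ e) → e ≤ 8 * n * (d ∸ 1)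
        high⇒ n zero          _ d-high = contradiction (≤-trans (≤-reflexive (*-zeroʳ (4 * n))) z≤n) d-high
        high⇒ n (suc zero)    4n≤e d-high = contradiction (≤-trans (≤-reflexive (*-identityʳ (4 * n))) 4n≤e) d-high
        high⇒ n (suc (suc d)) _ d-high = ≤-trans (<⇒≤ (≰⇒> d-high)) (≤-trans (m≤m+n _ (4 * n * d)) (≤-reflexive (ring n d)))
          where
          ring : ∀ n d → 4 * n * suc (suc d) + 4 * n * d ≡ 8 * n * suc d
          ring = solve-∀

        -- If both degrees are high, the two estimates of `high⇒` multiply, with 8a ∙ 8b = 64ab;
        -- otherwise e² is charged to a low end.
        edge-≤ : ∀ {x y} → 4 * a ≤ e → 4 * b ≤ e →
                 e * e ≤ 64 * (a * b) * ((x ∸ 1) * (y ∸ 1)) + (e * e * low a x + e * e * low b y)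
        edge-≤ {x} {y} 4a≤e 4b≤e = go (4 * a * x ≤? e) (4 * b * y ≤? e)
          where
          ring : ∀ a b x y → 8 * a * x * (8 * b * y) ≡ 64 * (a * b) * (x * y)
          ring = solve-∀
          go : (x? : Dec (4 * a * x ≤ e)) (y? : Dec (4 * b * y ≤ e)) →
               e * e ≤ 64 * (a * b) * ((x ∸ 1) * (y ∸ 1)) + (e * e * ind (does x?) + e * e * ind (does y?))
          go (yes _) y?      = ≤-trans (≤-trans (≤-reflexive (sym (*-identityʳ (e * e)))) (m≤m+n _ (e * e * ind (does y?)))) (m≤n+m _ (64 * (a * b) * ((x ∸ 1) * (y ∸ 1))))
          go (no hx) (yes _) = ≤-trans (≤-trans (≤-reflexive (sym (*-identityʳ (e * e)))) (m≤n+m _ (e * e * 0))) (m≤n+m _ (64 * (a * b) * ((x ∸ 1) * (y ∸ 1))))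
          go (no hx) (no hy) = ≤-trans (≤-trans (*-mono-≤ (high⇒ a x 4a≤e hx) (high⇒ b y 4b≤e hy))
                                 (≤-reflexive (ring a b (x ∸ 1) (y ∸ 1)))) (m≤m+n _ (e * e * 0 + e * e * 0))

      -- Summing `edge-≤` over all edges, with at most e / 4 edges at low vertices of either part,
      -- gives e³ ≤ 64t(ab)² + e³ / 2. The chain is this inequality times 4; cancelling 2e³ and then
      -- 2 leaves the constant 128.
      #edges-cube-≤ : 4 * a ≤ e → 4 * b ≤ e → 0 < a → 0 < b → e * (e * e) ≤ 128 * t * (a * b * (a * b))
      #edges-cube-≤ 4a≤e 4b≤e 0<a 0<b = *-cancelˡ-≤ 2 (+-cancelʳ-≤ (2 * (e * (e * e))) _ _ (begin
        2 * (e * (e * e)) + 2 * (e * (e * e))    ≡⟨ ring₁ e ⟩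
        4 * (e * e * e)                          ≡⟨ cong (λ s → 4 * (e * e * s)) (#edges≡sum G) ⟩
        4 * (e * e * ∑∑ (λ i j → ind (E i j)))   ≡⟨ cong (4 *_) (sym (∑∑-* (e * e) (λ i j → ind (E i j)))) ⟩
        4 * ∑∑ (λ i j → e * e * ind (E i j))     ≤⟨ *-monoʳ-≤ 4 (∑∑-mono pointwise) ⟩
        4 * ∑∑ (λ i j → K * P i j + (e * e * A i j + e * e * B i j))
          ≡⟨ cong (4 *_) (trans (∑∑-+ (λ i j → K * P i j) _) (cong₂ _+_ (∑∑-* K P)
               (trans (∑∑-+ (λ i j → e * e * A i j) (λ i j → e * e * B i j)) (cong₂ _+_ (∑∑-* (e * e) A) (∑∑-* (e * e) B))))) ⟩
        4 * (K * ∑∑ P + (e * e * ∑∑ A + e * e * ∑∑ B)) ≡⟨ ring₂ K (∑∑ P) (e * e) (∑∑ A) (∑∑ B) ⟩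
        4 * K * ∑∑ P + (e * e * (4 * ∑∑ A) + e * e * (4 * ∑∑ B))
          ≤⟨ +-mono-≤ (*-monoʳ-≤ (4 * K) ∑∑-paths) (+-mono-≤ (*-monoʳ-≤ (e * e) 4A≤e) (*-monoʳ-≤ (e * e) 4B≤e)) ⟩
        4 * K * (a * (b * t)) + (e * e * e + e * e * e) ≡⟨ ring₃ a b t e ⟩
        2 * (128 * t * (a * b * (a * b))) + 2 * (e * (e * e)) ∎))
        where
        open ≤-Reasoning
        K = 64 * (a * b)
        P A B : Fin a → Fin b → ℕ
        P i j = ind (E i j) * ((degA i ∸ 1) * (degB j ∸ 1))
        A i j = low a (degA i) * ind (E i j)
        B i j = low b (degB j) * ind (E i j)
        pointwise : ∀ i j → e * e * ind (E i j) ≤ K * P i j + (e * e * A i j + e * e * B i j)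
        pointwise i j with E i j
        ... | false = ≤-trans (≤-reflexive (*-zeroʳ (e * e))) z≤n
        ... | true  = ≤-trans (≤-reflexive (*-identityʳ (e * e))) (≤-trans (edge-≤ {degA i} {degB j} 4a≤e 4b≤e)
                        (≤-reflexive (ring K ((degA i ∸ 1) * (degB j ∸ 1)) (e * e) (low a (degA i)) (low b (degB j)))))
          where
          ring : ∀ k p s x y → k * p + (s * x + s * y) ≡ k * (1 * p) + (s * (x * 1) + s * (y * 1))
          ring = solve-∀
        4A≤e : 4 * ∑∑ A ≤ e
        4A≤e = ≤-trans (≤-reflexive (cong (4 *_) (sum-cong-≗ λ i → sym (*-distribˡ-sum (low a (degA i)) (ind ∘ E i))))) (∑low-≤ degA 0<a)
        4B≤e : 4 * ∑∑ B ≤ e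
        4B≤e = ≤-trans (≤-reflexive (cong (4 *_) (trans (∑-comm B)
          (sum-cong-≗ λ j → sym (*-distribˡ-sum (low b (degB j)) (λ i → ind (E i j))))))) (∑low-≤ degB 0<b)
        ring₁ : ∀ e → 2 * (e * (e * e)) + 2 * (e * (e * e)) ≡ 4 * (e * e * e)
        ring₁ = solve-∀
        ring₂ : ∀ K P s A B → 4 * (K * P + (s * A + s * B)) ≡ 4 * K * P + (s * (4 * A) + s * (4 * B))
        ring₂ = solve-∀
        ring₃ : ∀ a b t e → 4 * (64 * (a * b)) * (a * (b * t)) + (e * e * e + e * e * e) ≡ 2 * (128 * t * (a * b * (a * b))) + 2 * (e * (e * e))
        ring₃ = solve-∀

  -- `greatest` falls back to 0, which may fail P. In `ex-≤` that case is harmless, as 0 is below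
  -- every bound.
  greatest-zero-or-holds : ∀ {ℓ} {P : ℕ → Set ℓ} (P? : Decidable P) k → greatest P? k ≡ 0 ⊎ P (greatest P? k)
  greatest-zero-or-holds P? zero = inj₁ refl
  greatest-zero-or-holds P? (suc k) with P? (suc k)
  ... | yes p = inj₂ p
  ... | no _  = greatest-zero-or-holds P? k

  ex-≤ : ∀ a b t → 0 < a → 0 < b → let e = ex a b (C₄ ∷ θ₃ t ∷ []) in
         e ≤ 4 * a ⊎ e ≤ 4 * b ⊎ e * (e * e) ≤ 128 * t * (a * b * (a * b))
  ex-≤ a b t 0<a 0<b = go _ (greatest-zero-or-holds (attains? a b (C₄ ∷ θ₃ t ∷ [])) (a * b))
    where
    go : ∀ e → e ≡ 0 ⊎ Attains a b (C₄ ∷ θ₃ t ∷ []) e →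
         e ≤ 4 * a ⊎ e ≤ 4 * b ⊎ e * (e * e) ≤ 128 * t * (a * b * (a * b))
    go _ (inj₁ refl) = inj₁ z≤n
    go e (inj₂ (G , (C₄-free ∷ θ₃-free ∷ []) , refl)) with ≤-total e (4 * a) | ≤-total e (4 * b)
    ... | inj₁ e≤4a | _         = inj₁ e≤4a
    ... | inj₂ _    | inj₁ e≤4b = inj₂ (inj₁ e≤4b)
    ... | inj₂ 4a≤e | inj₂ 4b≤e = inj₂ (inj₂ (#edges-cube-≤ G C₄-free θ₃-free 4a≤e 4b≤e 0<a 0<b))

-- Choice of the prime, comparison of exponents, and passage to rational constants.

module Bounds where

  open PrimesInIntervals using (prime-between)
  open PolynomialsModP using (Anisotropic; anisotropic)
  open LinesOverFp using (module Incidence)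
  open IncidenceGraphs using (incidence≤ex)
  open PathCounting using (ex-≤)
  open import Defs
  open import Data.Integer as ℤ using (+_)
  import Data.Integer.Properties as ℤ
  open import Data.List using (_∷_; [])
  open import Data.Nat as ℕ using (ℕ; zero; suc; s≤s; z≤n; _+_; _*_; _^_; _≤_; NonZero)
  open import Data.Nat.Properties as ℕ using (_≤?_)
  open import Data.Nat.Primality
  import Data.Nat.Tactic.RingSolver as NatRing
  open import Data.Product using (∃-syntax; _×_; _,_)
  open import Data.Sum using (_⊎_; inj₁; inj₂)
  open import Data.Rational as ℚ using (ℚ; 0ℚ; 1ℚ; _<_)
  import Data.Rational.Properties as ℚ
  open import Algebra.Bundles using (CommutativeRing)
  open import Algebra.Properties.CommutativeSemiring.Exp (CommutativeRing.commutativeSemiring ℚ.+-*-commutativeRing) using (^-distrib-*)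
  open import Data.Rational.Unnormalised as ℚᵘ using (mkℚᵘ; *≡*; *≤*)
  import Data.Rational.Unnormalised.Properties as ℚᵘ
  open import Relation.Binary.PropositionalEquality

  toℚᵘ-ℕ→ℚ : ∀ n → ℚ.toℚᵘ (ℕ→ℚ n) ℚᵘ.≃ mkℚᵘ (+ n) 0
  toℚᵘ-ℕ→ℚ n = ℚ.toℚᵘ-fromℚᵘ (mkℚᵘ (+ n) 0)

  ℕ→ℚ-* : ∀ m n → ℕ→ℚ (m * n) ≡ ℕ→ℚ m ℚ.* ℕ→ℚ n
  ℕ→ℚ-* m n = ℚ.toℚᵘ-injective (ℚᵘ.≃-trans (toℚᵘ-ℕ→ℚ (m * n)) (ℚᵘ.≃-sym
    (ℚᵘ.≃-trans (ℚ.toℚᵘ-homo-* (ℕ→ℚ m) (ℕ→ℚ n))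
      (ℚᵘ.≃-trans (ℚᵘ.*-cong (toℚᵘ-ℕ→ℚ m) (toℚᵘ-ℕ→ℚ n)) (*≡* (cong (ℤ._* + 1) (sym (ℤ.pos-* m n))))))))

  ℕ→ℚ-^ : ∀ n k → ℕ→ℚ (n ^ k) ≡ ℕ→ℚ n ^ℚ k
  ℕ→ℚ-^ n zero    = refl
  ℕ→ℚ-^ n (suc k) = trans (ℕ→ℚ-* n (n ^ k)) (cong (ℕ→ℚ n ℚ.*_) (ℕ→ℚ-^ n k))

  ℕ→ℚ-mono : ∀ {m n} → m ≤ n → ℕ→ℚ m ℚ.≤ ℕ→ℚ n
  ℕ→ℚ-mono {m} {n} m≤n = ℚ.toℚᵘ-cancel-≤ (ℚᵘ.≤-respˡ-≃ (ℚᵘ.≃-sym (toℚᵘ-ℕ→ℚ m))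
    (ℚᵘ.≤-respʳ-≃ (ℚᵘ.≃-sym (toℚᵘ-ℕ→ℚ n)) (*≤* (ℤ.*-monoʳ-≤-nonNeg (+ 1) (ℤ.+≤+ m≤n)))))

  ^ℚ-nonNeg : ∀ {x} k → 0ℚ ℚ.≤ x → 0ℚ ℚ.≤ x ^ℚ k
  ^ℚ-nonNeg zero    _ = ℕ→ℚ-mono {0} {1} z≤n
  ^ℚ-nonNeg {x} (suc k) 0≤x = ℚ.≤-trans (ℚ.≤-reflexive (sym (ℚ.*-zeroʳ x)))
    (ℚ.*-monoˡ-≤-nonNeg x {{ℚ.nonNegative 0≤x}} (^ℚ-nonNeg k 0≤x))

  1/ : (d : ℕ) .{{_ : NonZero d}} → ℚ
  1/ d = + 1 ℚ./ d

  1/-inverse : ∀ d .{{_ : NonZero d}} → 1/ d ℚ.* ℕ→ℚ d ≡ 1ℚ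
  1/-inverse d@(suc k) = ℚ.toℚᵘ-injective (ℚᵘ.≃-trans (ℚ.toℚᵘ-homo-* (1/ d) (ℕ→ℚ d))
    (ℚᵘ.≃-trans (ℚᵘ.*-cong (ℚ.toℚᵘ-fromℚᵘ (mkℚᵘ (+ 1) k)) (toℚᵘ-ℕ→ℚ d)) (*≡* (cong +_ (ring k)))))
    where
    ring : ∀ k → suc (k + 0) * 1 ≡ suc (k * 1) + 0
    ring = NatRing.solve-∀

  0<1/ : ∀ d .{{_ : NonZero d}} → 0ℚ < 1/ d
  0<1/ d = ℚ.positive⁻¹ (1/ d) {{ℚ.normalize-pos 1 d}}

  0<ℕ→ℚ : ∀ n .{{_ : NonZero n}} → 0ℚ < ℕ→ℚ n
  0<ℕ→ℚ n = ℚ.positive⁻¹ (ℕ→ℚ n) {{ℚ.normalize-pos n 1}}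

  ≤-power-upper : ∀ {c n p q x} .{{_ : NonZero q}} → x ^ q ≤ c ^ q * n ^ p → x ≤ ℕ→ℚ c · n ^[ p / q ]
  ≤-power-upper {c} {n} {p} {q} {x} le = begin
    ℕ→ℚ x ^ℚ q                    ≡⟨ sym (ℕ→ℚ-^ x q) ⟩
    ℕ→ℚ (x ^ q)                   ≤⟨ ℕ→ℚ-mono le ⟩
    ℕ→ℚ (c ^ q * n ^ p)           ≡⟨ ℕ→ℚ-* (c ^ q) (n ^ p) ⟩
    ℕ→ℚ (c ^ q) ℚ.* ℕ→ℚ (n ^ p)   ≡⟨ cong (ℚ._* ℕ→ℚ (n ^ p)) (ℕ→ℚ-^ c q) ⟩
    (ℕ→ℚ c ^ℚ q) ℚ.* ℕ→ℚ (n ^ p) ∎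
    where open ℚ.≤-Reasoning

  -- With a constant of the form 1/d, clearing d leaves an inequality between natural numbers, where
  -- the combinatorial bounds are proved.
  power-lower-≤ : ∀ {d n p q x} .{{_ : NonZero d}} .{{_ : NonZero q}} → n ^ p ≤ (d * x) ^ q → 1/ d · n ^[ p / q ]≤ x
  power-lower-≤ {d} {n} {p} {q} {x} le = begin
    C ℚ.* ℕ→ℚ (n ^ p)              ≤⟨ ℚ.*-monoˡ-≤-nonNeg C {{ℚ.nonNegative (^ℚ-nonNeg q (ℚ.<⇒≤ (0<1/ d)))}} (ℕ→ℚ-mono le) ⟩
    C ℚ.* ℕ→ℚ ((d * x) ^ q)        ≡⟨ cong (C ℚ.*_) (trans (ℕ→ℚ-^ (d * x) q) (cong (_^ℚ q) (ℕ→ℚ-* d x))) ⟩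
    C ℚ.* ((ℕ→ℚ d ℚ.* ℕ→ℚ x) ^ℚ q) ≡⟨ sym (^-distrib-* (1/ d) (ℕ→ℚ d ℚ.* ℕ→ℚ x) q) ⟩
    (1/ d ℚ.* (ℕ→ℚ d ℚ.* ℕ→ℚ x)) ^ℚ q ≡⟨ cong (_^ℚ q) (trans (sym (ℚ.*-assoc (1/ d) (ℕ→ℚ d) (ℕ→ℚ x)))
                                        (trans (cong (ℚ._* ℕ→ℚ x) (1/-inverse d)) (ℚ.*-identityˡ (ℕ→ℚ x)))) ⟩
    ℕ→ℚ x ^ℚ q ∎
    where
    open ℚ.≤-Reasoning
    C = 1/ d ^ℚ q

  ^-*-distrib : ∀ x y k → (x * y) ^ k ≡ x ^ k * y ^ k
  ^-*-distrib x y zero    = refl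
  ^-*-distrib x y (suc k) = trans (cong (x * y *_) (^-*-distrib x y k)) (ring x y (x ^ k) (y ^ k))
    where
    ring : ∀ x y a b → x * y * (a * b) ≡ x * a * (y * b)
    ring = NatRing.solve-∀

  ^-swap : ∀ x k l → (x ^ k) ^ l ≡ (x ^ l) ^ k
  ^-swap x k l = trans (ℕ.^-*-assoc x k l) (trans (cong (x ^_) (ℕ.*-comm k l)) (sym (ℕ.^-*-assoc x l k)))

  ^-cancel-≤ : ∀ {m n} k .{{_ : NonZero k}} → m ^ k ≤ n ^ k → m ≤ n
  ^-cancel-≤ {m} {n} k le = ℕ.≮⇒≥ λ n<m → ℕ.<⇒≱ (ℕ.^-monoˡ-< k n<m) le

  x≤4n⇒ : ∀ {c n q x} .{{_ : NonZero n}} → 4 ≤ c → x ≤ 4 * n → x ^ q ≤ c ^ q * n ^ (q + 1)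
  x≤4n⇒ {c} {n} {q} {x} 4≤c x≤4n = begin
    x ^ q               ≤⟨ ℕ.^-monoˡ-≤ q x≤4n ⟩
    (4 * n) ^ q         ≡⟨ ^-*-distrib 4 n q ⟩
    4 ^ q * n ^ q       ≤⟨ ℕ.*-mono-≤ (ℕ.^-monoˡ-≤ q 4≤c) (ℕ.^-monoʳ-≤ n (ℕ.m≤m+n q 1)) ⟩
    c ^ q * n ^ (q + 1) ∎
    where open ℕ.≤-Reasoning

  -- The exponents meet because 2(q + t + 2) = 3(q + 1) for q = 2t + 1. Roots are avoided by
  -- comparing cubes of q-th powers, and `c ^ q` is enlarged to its cube so that the right side
  -- becomes a cube.
  x³≤c[nm]²⇒ : ∀ {c n m t q x} → 1 + 2 * t ≡ q → m ^ q ≤ n ^ (t + 2) → x * (x * x) ≤ c * (n * m * (n * m)) →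
               x ^ q ≤ c ^ q * n ^ (q + 1)
  x³≤c[nm]²⇒ {c} {n} {m} {t} {q} {x} 1+2t≡q m≤ x³≤ = ^-cancel-≤ 3 (begin
    (x ^ q) ^ 3                                ≡⟨ ^-swap x q 3 ⟩
    (x ^ 3) ^ q                                ≡⟨ cong (λ y → (x * (x * y)) ^ q) (ℕ.*-identityʳ x) ⟩
    (x * (x * x)) ^ q                          ≤⟨ ℕ.^-monoˡ-≤ q x³≤ ⟩
    (c * (n * m * (n * m))) ^ q                ≡⟨ trans (^-*-distrib c (n * m * (n * m)) q) (cong (c ^ q *_)
                                                    (trans (^-*-distrib (n * m) (n * m) q) (cong (λ y → y * y) (^-*-distrib n m q)))) ⟩
    c ^ q * (n ^ q * m ^ q * (n ^ q * m ^ q))  ≤⟨ ℕ.*-mono-≤ (m≤m^q (c ^ q) 3) (ℕ.*-mono-≤ nm≤ nm≤) ⟩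
    (c ^ q) ^ 3 * (n ^ r * n ^ r)              ≡⟨ cong ((c ^ q) ^ 3 *_) (trans (sym (ℕ.^-distribˡ-+-* n r r))
                                                    (trans (cong (n ^_) exponent) (sym (ℕ.^-*-assoc n (q + 1) 3)))) ⟩
    (c ^ q) ^ 3 * (n ^ (q + 1)) ^ 3            ≡⟨ sym (^-*-distrib (c ^ q) (n ^ (q + 1)) 3) ⟩
    (c ^ q * n ^ (q + 1)) ^ 3 ∎)
    where
    open ℕ.≤-Reasoning
    r = q + (t + 2)
    nm≤ : n ^ q * m ^ q ≤ n ^ r
    nm≤ = ℕ.≤-trans (ℕ.*-monoʳ-≤ (n ^ q) m≤) (ℕ.≤-reflexive (sym (ℕ.^-distribˡ-+-* n q (t + 2))))
    ring : ∀ t → 1 + 2 * t + (t + 2) + (1 + 2 * t + (t + 2)) ≡ (1 + 2 * t + 1) * 3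
    ring = NatRing.solve-∀
    exponent : r + r ≡ (q + 1) * 3
    exponent = subst (λ q → q + (t + 2) + (q + (t + 2)) ≡ (q + 1) * 3) 1+2t≡q (ring t)

  ex-power-≤ : ∀ {n m t q} .{{_ : NonZero q}} → 1 + 2 * t ≡ q → 1 ≤ t → 1 ≤ n → 1 ≤ m → m ^ q ≤ n ^ (t + 2) →
               ex n m (C₄ ∷ θ₃ t ∷ []) ^ q ≤ (128 * t) ^ q * n ^ (q + 1)
  ex-power-≤ {n} {m} {t} {q} 1+2t≡q 1≤t 1≤n 1≤m m≤ = go _ (ex-≤ n m t 1≤n 1≤m)
    where
    instance
      n≢0 : NonZero n
      n≢0 = ℕ.>-nonZero 1≤n
    t+2≤q : t + 2 ≤ q
    t+2≤q = begin
      t + 2        ≡⟨ ring t ⟩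
      1 + (t + 1)  ≤⟨ ℕ.+-monoʳ-≤ (1 + t) 1≤t ⟩
      1 + (t + t)  ≡⟨ ring′ t ⟩
      1 + 2 * t    ≡⟨ 1+2t≡q ⟩
      q ∎
      where
      open ℕ.≤-Reasoning
      ring : ∀ t → t + 2 ≡ 1 + (t + 1)
      ring = NatRing.solve-∀
      ring′ : ∀ t → 1 + (t + t) ≡ 1 + 2 * t
      ring′ = NatRing.solve-∀
    -- Reduces the case of at most 4m edges to that of at most 4n.
    m≤n : m ≤ n
    m≤n = ^-cancel-≤ q (ℕ.≤-trans m≤ (ℕ.^-monoʳ-≤ n t+2≤q))
    4≤c : 4 ≤ 128 * t
    4≤c = ℕ.*-mono-≤ {4} {128} {1} {t} (ℕ.m≤m+n 4 124) 1≤t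
    go : ∀ x → x ≤ 4 * n ⊎ x ≤ 4 * m ⊎ x * (x * x) ≤ 128 * t * (n * m * (n * m)) → x ^ q ≤ (128 * t) ^ q * n ^ (q + 1)
    go x (inj₁ x≤4n)        = x≤4n⇒ {q = q} 4≤c x≤4n
    go x (inj₂ (inj₁ x≤4m)) = x≤4n⇒ {q = q} 4≤c (ℕ.≤-trans x≤4m (ℕ.*-monoʳ-≤ 4 m≤n))
    go x (inj₂ (inj₂ x³≤))  = x³≤c[nm]²⇒ {t = t} 1+2t≡q m≤ x³≤

  bracket : ∀ B → 1 ℕ.< B → ∀ n → 0 ℕ.< n → ∃[ k ] ((B ^ k ≤ n) × (n ℕ.< B ^ suc k))
  bracket B 1<B (suc zero) _ = 0 , s≤s z≤n , ℕ.<-≤-trans 1<B (ℕ.≤-reflexive (sym (ℕ.*-identityʳ B)))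
  bracket B 1<B (suc n@(suc _)) _ with bracket B 1<B n (s≤s z≤n)
  ... | k , Bᵏ≤n , n<B with ℕ.m≤n⇒m<n∨m≡n n<B
  ...   | inj₁ lt = k , ℕ.m≤n⇒m≤1+n Bᵏ≤n , lt
  ...   | inj₂ eq = suc k , ℕ.≤-reflexive (sym eq) ,
          ℕ.≤-trans (ℕ.≤-reflexive (cong suc eq)) (ℕ.^-monoʳ-< B 1<B (ℕ.n<1+n (suc k)))

  -- The constant 16 is 4 ∙ 4: one factor for the consecutive powers of `4 ^ q` that bracket n, one
  -- for the interval that contains p. The threshold exponent 9 leaves h ≥ 8, as `prime-between`
  -- requires.
  prime-root : ∀ q .{{_ : NonZero q}} n → (4 ^ q) ^ 9 ≤ n → ∃[ p ] (Prime p × p ≢ 2 × p ^ q ≤ n × n ≤ (16 * p) ^ q)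
  prime-root q@(suc q′) n n≥ with bracket (4 ^ q) 1<4^q n (ℕ.<-≤-trans (ℕ.m^n>0 (4 ^ q) {{ℕ.m^n≢0 4 q}} 9) n≥)
    where
    1<4^q : 1 ℕ.< 4 ^ q
    1<4^q = ℕ.^-monoʳ-< 4 (s≤s (s≤s z≤n)) {0} {q} (s≤s z≤n)
  ... | k , ≤n , n< = pick k (ℕ.s≤s⁻¹ (ℕ.≰⇒> λ k<9 → ℕ.<⇒≱ (ℕ.<-≤-trans n< (ℕ.^-monoʳ-≤ (4 ^ q) {{ℕ.m^n≢0 4 q}} k<9)) n≥)) ≤n n<
    where
    pick : ∀ k → 9 ≤ k → (4 ^ q) ^ k ≤ n → n ℕ.< (4 ^ q) ^ suc k → ∃[ p ] (Prime p × p ≢ 2 × p ^ q ≤ n × n ≤ (16 * p) ^ q)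
    pick (suc h) (s≤s 8≤h) ≤n n< with prime-between h 8≤h
    ... | p , pr , 4ʰ<p , p≤ = p , pr , p≢2 ,
      ℕ.≤-trans (ℕ.^-monoˡ-≤ q p≤) (ℕ.≤-trans (ℕ.≤-reflexive (^-swap 4 (suc h) q)) ≤n) ,
      ℕ.≤-trans (ℕ.<⇒≤ n<) (ℕ.≤-trans (ℕ.≤-reflexive (^-swap 4 q (suc (suc h))))
        (ℕ.^-monoˡ-≤ q (ℕ.≤-trans (ℕ.≤-reflexive (sym (ℕ.*-assoc 4 4 (4 ^ h)))) (ℕ.*-monoʳ-≤ 16 (ℕ.<⇒≤ 4ʰ<p)))))
      where
      p≢2 : p ≢ 2
      p≢2 refl = ℕ.<⇒≱ 4ʰ<p (ℕ.≤-trans (s≤s (s≤s z≤n)) (ℕ.^-monoʳ-≤ 4 {1} {h} (ℕ.≤-trans (s≤s z≤n) 8≤h)))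

  incidence-edges : ∀ t {q n m p α} → 2 ≤ t → 1 + 2 * t ≡ q → (pr : Prime p) → Anisotropic pr α →
                    p ^ q ≤ n → p ^ (2 + t) ≤ m → p ^ (q + 1) ≤ ex n m (C₄ ∷ θ₃ t ∷ [])
  incidence-edges (suc zero) (s≤s ())
  incidence-edges t@(suc (suc k)) {q} {n} {m} {p} {α} _ 1+2t≡q pr an pq≤n M≤m = begin
    p ^ (q + 1)    ≡⟨ cong (p ^_) (ℕ.+-comm q 1) ⟩
    p * p ^ q      ≡⟨ ℕ.*-comm p (p ^ q) ⟩
    p ^ q * p      ≡⟨ cong (λ s → p ^ s * p) (sym 1+t+t≡q) ⟩
    I.#lines * p   ≤⟨ incidence≤ex N≤n M≤m I.inc? I.no-C₄ (s≤s z≤n) I.no-θ₃ I.point I.point< I.point-injective I.inc-point ⟩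
    ex n m (C₄ ∷ θ₃ t ∷ []) ∎
    where
    open ℕ.≤-Reasoning
    module I = Incidence pr {α} an k
    1+t+t≡q : 1 + t + t ≡ q
    1+t+t≡q = trans (cong (λ s → 1 + t + s) (sym (ℕ.+-identityʳ t))) 1+2t≡q
    N≤n : I.#lines ≤ n
    N≤n = ℕ.≤-trans (ℕ.≤-reflexive (cong (p ^_) 1+t+t≡q)) pq≤n

  ≤floor : ∀ {n p q x} .{{_ : NonZero q}} → x ^ q ≤ n ^ p → x ≤ ⌊ n ^[ p / q ]⌋
  ≤floor {n} {p} {q} {x} le = greatest-upper (λ m → m ^ q ≤? n ^ p) (n ^ p) (ℕ.≤-trans (m≤m^q x q) le) le

  -- One prime fits the construction into both parts: p^q ≤ n makes room for the lines, and its
  -- power (p^q)^(t + 2) ≤ n^(t + 2) puts the number of points below the floor.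
  ex-lower : ∀ {t q n} .{{_ : NonZero q}} → 2 ≤ t → 1 + 2 * t ≡ q → (4 ^ q) ^ 9 ≤ n →
             ∃[ p ] ((n ≤ (16 * p) ^ q) × (p ^ (q + 1) ≤ ex n ⌊ n ^[ (t + 2) / q ]⌋ (C₄ ∷ θ₃ t ∷ [])))
  ex-lower {t} {q} {n} 2≤t 1+2t≡q n≥ = go (prime-root q n n≥)
    where
    open ℕ.≤-Reasoning
    points≤ : ∀ {p} → p ^ q ≤ n → (p ^ (2 + t)) ^ q ≤ n ^ (t + 2)
    points≤ {p} pq≤n = begin
      (p ^ (2 + t)) ^ q  ≡⟨ ^-swap p (2 + t) q ⟩
      (p ^ q) ^ (2 + t)  ≤⟨ ℕ.^-monoˡ-≤ (2 + t) pq≤n ⟩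
      n ^ (2 + t)        ≡⟨ cong (n ^_) (ℕ.+-comm 2 t) ⟩
      n ^ (t + 2) ∎
    edges : ∀ {p} (pr : Prime p) → p ^ q ≤ n → ∃[ α ] Anisotropic pr α →
            p ^ (q + 1) ≤ ex n ⌊ n ^[ (t + 2) / q ]⌋ (C₄ ∷ θ₃ t ∷ [])
    edges {p} pr pq≤n (α , an) = incidence-edges t {q} {n} {_} {p} {α} 2≤t 1+2t≡q pr an pq≤n
      (≤floor {n} {t + 2} {q} {p ^ (2 + t)} (points≤ pq≤n))
    go : ∃[ p ] (Prime p × p ≢ 2 × p ^ q ≤ n × n ≤ (16 * p) ^ q) →
         ∃[ p ] ((n ≤ (16 * p) ^ q) × (p ^ (q + 1) ≤ ex n ⌊ n ^[ (t + 2) / q ]⌋ (C₄ ∷ θ₃ t ∷ [])))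
    go (p , pr , p≢2 , pq≤n , n≤) = p , n≤ , edges pr pq≤n (anisotropic pr p≢2)

  ex-upper-power : ∀ {t q n} .{{_ : NonZero q}} → 2 ≤ t → 1 + 2 * t ≡ q → 1 ≤ n →
                   ex n ⌊ n ^[ (t + 2) / q ]⌋ (C₄ ∷ θ₃ t ∷ []) ^ q ≤ (128 * t) ^ q * n ^ (q + 1)
  ex-upper-power {t} {q} {n} 2≤t 1+2t≡q 1≤n =
    ex-power-≤ {n} {_} {t} {q} 1+2t≡q (ℕ.≤-trans (s≤s z≤n) 2≤t) 1≤n 1≤floor (floor-lower n (t + 2) q)
    where
    1≤floor : 1 ≤ ⌊ n ^[ (t + 2) / q ]⌋
    1≤floor = ≤floor {n} {t + 2} {q} {1} (ℕ.≤-trans (ℕ.≤-reflexive (ℕ.^-zeroˡ q)) (ℕ.m^n>0 n {{ℕ.>-nonZero 1≤n}} (t + 2)))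

  -- Stated for variable e and q because Agda would unfold ex and the powers otherwise.
  rational-bounds : ∀ (e : ℕ → ℕ) c q .{{_ : NonZero c}} .{{_ : NonZero q}} →
    (∀ {n} → (4 ^ q) ^ 9 ≤ n → ∃[ p ] ((n ≤ (16 * p) ^ q) × (p ^ (q + 1) ≤ e n))) →
    (∀ {n} → 1 ≤ n → e n ^ q ≤ c ^ q * n ^ (q + 1)) →
    ∃[ c₁ ] ∃[ c₂ ] ∃[ n₀ ]
      ((0ℚ < c₁) × (0ℚ < c₂) ×
       ((n : ℕ) → n₀ ≤ n → (c₁ · n ^[ (q + 1) / q ]≤ e n) × (e n ≤ c₂ · n ^[ (q + 1) / q ])))
  rational-bounds e c q low up =
    1/ d , ℕ→ℚ c , (4 ^ q) ^ 9 , 0<1/ d , 0<ℕ→ℚ c ,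
    λ n n≥ → let p , n≤ , p≤ = low n≥ in
      power-lower-≤ {d} {n} {q + 1} {q} {e n} (begin
        n ^ (q + 1)                ≤⟨ ℕ.^-monoˡ-≤ (q + 1) n≤ ⟩
        ((16 * p) ^ q) ^ (q + 1)   ≡⟨ ^-swap (16 * p) q (q + 1) ⟩
        ((16 * p) ^ (q + 1)) ^ q   ≡⟨ cong (_^ q) (^-*-distrib 16 p (q + 1)) ⟩
        (d * p ^ (q + 1)) ^ q      ≤⟨ ℕ.^-monoˡ-≤ q (ℕ.*-monoʳ-≤ d p≤) ⟩
        (d * e n) ^ q ∎) ,
      ≤-power-upper {c} {n} {q + 1} {q} {e n} (up (ℕ.≤-trans (ℕ.m^n>0 (4 ^ q) {{ℕ.m^n≢0 4 q}} 9) n≥))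
    where
    open ℕ.≤-Reasoning
    -- Raising n ≤ (16p)^q to the power (q + 1) / q turns the factor 16 into this one.
    d = 16 ^ (q + 1)
    instance
      d≢0 : NonZero d
      d≢0 = ℕ.m^n≢0 16 (q + 1)

open Bounds using (rational-bounds; ex-lower; ex-upper-power)
open import Defs
open import Data.List using ([]; _∷_)
open import Data.Nat using (ℕ; _+_; _*_; _≤_; s≤s; z≤n; nonZero; >-nonZero)
open import Data.Nat.Properties using (≤-trans; m*n≢0)
open import Data.Product using (∃-syntax; _×_)
open import Data.Rational using (ℚ; 0ℚ; _<_)
open import Relation.Binary.PropositionalEquality using (refl)

theorem1p2 : (t : ℕ) → 2 ≤ t →
    let q = 1 + 2 * t
        e = λ n → ex n ⌊ n ^[ (t + 2) / q ]⌋ (C₄ ∷ θ₃ t ∷ [])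
    in
    ∃[ c₁ ] ∃[ c₂ ] ∃[ n₀ ]
      ((0ℚ < c₁) × (0ℚ < c₂) ×
       ((n : ℕ) → n₀ ≤ n →
          (c₁ · n ^[ (q + 1) / q ]≤ e n) ×
          (e n ≤ c₂ · n ^[ (q + 1) / q ])))
theorem1p2 t 2≤t =
  rational-bounds _ (128 * t) (1 + 2 * t)
    {{m*n≢0 128 t {{nonZero}} {{>-nonZero (≤-trans (s≤s z≤n) 2≤t)}}}}
    (ex-lower {t} {1 + 2 * t} 2≤t refl) (ex-upper-power {t} {1 + 2 * t} 2≤t refl)
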